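{- Let $\mathcal{M}$ be the union of the graph matroid families $\mathcal{M}_1,\ldots,\mathcal{M}_k$, i.e., $\mathcal{M}(G)=\mathcal{M}_1(G)\cup\cdots\cup\mathcal{M}_k(G)$ for every graph $G$. If each of $\mathcal{M}_1,\ldots,\mathcal{M}_k$ has the Lovász-Yemini property, then so does $\mathcal{M}$.
   Context: All graphs are finite and simple, without isolated vertices. A graph matroid family $\mathcal{M}$ assigns to every graph $G$ a matroid $\mathcal{M}(G)$ on $E(G)$ such that (i) every graph isomorphism $\varphi:V(G)\to V(H)$ induces, via $uv\mapsto\varphi(u)\varphi(v)$, an isomorphism $\mathcal{M}(G)\to\mathcal{M}(H)$, and (ii) for every subgraph $H$ of $G$, $\mathcal{M}(H)$ is the restriction of $\mathcal{M}(G)$ to $E(H)$. The union of matroids on a common ground set has as independent sets the unions $I_1\cup\cdots\cup I_k$ of independent sets $I_j$ of the respective matroids. With $r$ the rank function, $G$ is $\mathcal{M}$-rigid if $r(G)=r(K_{V(G)})$, where $K_V$ is the complete graph on $V$. $\mathcal{M}$ has the Lovász-Yemini property if there is a nonnegative integer $c$ such that every $c$-connected graph is $\mathcal{M}$-rigid. -}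

module Defs where

open import Data.Nat using (ℕ; _<_; _≤_; _<ᵇ_)
open import Data.Bool using (if_then_else_)
open import Data.Product using (Σ; ∃; ∃-syntax; _×_; _,_; proj₁; proj₂)
open import Data.Fin using (Fin)
open import Data.List using (List; []; _∷_; map; concatMap; length)
open import Data.List.Membership.Propositional using (_∈_; _∉_)
open import Data.List.Relation.Unary.All using (All)
open import Data.List.Relation.Unary.Unique.Propositional using (Unique)
open import Data.List.Relation.Binary.Subset.Propositional using (_⊆_)
open import Data.Sum using (_⊎_)
open import Relation.Binary.PropositionalEquality using (_≡_)
open import Function.Bundles using (_⇔_)

-- Graphs.
-- Vertices are natural numbers.  An edge uv is stored in normal form as
-- the pair (u , v) with u < v.  A graph is given by its (finite) list of
-- edges; lists are read as sets (duplicates/order irrelevant).  Since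
-- graphs have no isolated vertices, V(G) is the set of endpoints.

Edge : Set
Edge = ℕ × ℕ

Graph : Set
Graph = List Edge

WF : Graph → Set
WF G = All (λ e → proj₁ e < proj₂ e) G

V : Graph → List ℕ
V G = concatMap (λ e → proj₁ e ∷ proj₂ e ∷ []) G

K : List ℕ → Graph
K X = concatMap (λ u → concatMap (λ v → if u <ᵇ v then (u , v) ∷ [] else []) X) X

mapE : (ℕ → ℕ) → Edge → Edge
mapE φ (u , v) = if φ u <ᵇ φ v then (φ u , φ v) else (φ v , φ u)

InjectiveOn : (ℕ → ℕ) → List ℕ → Set
InjectiveOn φ X = ∀ {u v} → u ∈ X → v ∈ X → φ u ≡ φ v → u ≡ v

-- Graph matroid families.
-- Ind G I : "the edge list I is an independent set of M(G)".
-- Independent sets are duplicate-free lists of edges of G; set-level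
-- notions (subset, size) are taken through membership / length.

record MatroidFamily : Set₁ where
  field
    Ind        : Graph → List Edge → Set
    ind-⊆      : ∀ G I → WF G → Ind G I → I ⊆ G
    ind-unique : ∀ G I → WF G → Ind G I → Unique I
    ind-empty  : ∀ G → WF G → Ind G []
    ind-down   : ∀ G I J → WF G → Ind G J → I ⊆ J → Unique I → Ind G I
    ind-aug    : ∀ G I J → WF G → Ind G I → Ind G J → length I < length J →
                 ∃[ e ] (e ∈ J × e ∉ I × Ind G (e ∷ I))
    -- (i) isomorphism invariance: a map φ injective on V(G) is an
    -- isomorphism from G onto its image graph
    ind-iso    : ∀ G I (φ : ℕ → ℕ) → WF G → InjectiveOn φ (V G) → I ⊆ G →
                 Ind G I ⇔ Ind (map (mapE φ) G) (map (mapE φ) I)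
    ind-restr  : ∀ G H I → WF G → WF H → H ⊆ G → I ⊆ H →
                 Ind H I ⇔ Ind G I

open MatroidFamily public

HasRank : MatroidFamily → Graph → List Edge → ℕ → Set
HasRank M G X k =
  (∃[ I ] (Ind M G I × I ⊆ X × length I ≡ k)) ×
  (∀ I → Ind M G I → I ⊆ X → length I ≤ k)

Rigid : MatroidFamily → Graph → Set
Rigid M G = ∃[ k ] (HasRank M G G k × HasRank M (K (V G)) (K (V G)) k)

data Reach (G : Graph) (X : List ℕ) : ℕ → ℕ → Set where
  here : ∀ {u} → Reach G X u u
  step : ∀ {a b w} → ((a , b) ∈ G ⊎ (b , a) ∈ G) → a ∉ X → b ∉ X →
         Reach G X b w → Reach G X a w

Connected : ℕ → Graph → Set
Connected c G =
  (∃[ W ] (Unique W × W ⊆ V G × c < length W)) ×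
  (∀ X → Unique X → length X < c →
     ∀ u v → u ∈ V G → v ∈ V G → u ∉ X → v ∉ X → Reach G X u v)

LovaszYemini : MatroidFamily → Set
LovaszYemini M = ∃[ c ] (∀ G → WF G → Connected c G → Rigid M G)

UnionInd : ∀ {k} → (Fin k → MatroidFamily) → Graph → List Edge → Set
UnionInd {k} Ms G I =
  Unique I ×
  Σ (Fin k → List Edge) λ Is → ((∀ (j : Fin k) → Ind (Ms j) G (Is j)) ×
           (∀ e → e ∈ I ⇔ (∃[ j ] (e ∈ Is j))))

{-# OPTIONS --safe #-}
module Submission where

-- Let c exceed all the constants of the M_j.  Each M_j-closed set of edges is closed under
-- replacing a c-connected subgraph by the complete graph on its vertices.
--
-- Graph theory: if G is sufficiently connected (relative to k and c) and F ⊆ E(G), then some set Z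
-- of at most |E(G) ∖ F| / k edges makes F ∪ Z generate K_V(G) under this operation.  To find Z, split F
-- along separators of size < c, peeling off vertices of small degree, until it falls apart into
-- c-connected blocks and single vertices.  High connectivity of G forces many edges of G ∖ F to
-- leave these pieces, while c² new edges suffice to join two of them.
--
-- Matroid union: take disjoint I_j ⊆ E(G), with I_j independent in M_j, of maximal total size, and
-- let F be the set of edges that can be left uncovered after a chain of exchanges.  Then the I_j cover
-- E(G) ∖ F, and I_j ∩ F spans F in M_j.  Hence r_j(K_V(G)) ≤ |I_j ∩ F| + |Z| for every j, and summing
-- gives Σ r_j(K_V(G)) ≤ Σ |I_j|.
--
-- Independence is not decidable, so negated independence is replaced by "implies the goal A",
-- for which the classical argument goes through constructively.

open import Defs
open import Data.Nat
open import Data.Nat.Properties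
open import Data.Nat.Tactic.RingSolver using (solve-∀)
open import Data.Bool using (true; if_then_else_)
open import Data.Fin using (Fin)
import Data.Fin.Properties as Fin
open import Data.Maybe using (Maybe; just; nothing)
import Data.Maybe.Properties as Maybe
open import Data.Product using (Σ; ∃; ∃-syntax; _×_; _,_; proj₁; proj₂)
open import Data.Product.Properties using (≡-dec)
open import Data.Sum using (_⊎_; inj₁; inj₂; [_,_]′; swap)
open import Data.List using (List; []; _∷_; _++_; map; concatMap; length; filter; take; deduplicate; cartesianProduct; allFin)
open import Data.List.Properties using (length-++; length-map; length-filter; length-take; take-all; length-tabulate)
open import Data.List.Membership.Propositional using (_∈_; _∉_; lose; find)
open import Data.List.Membership.Propositional.Properties using (∈-filter⁺; ∈-filter⁻; ∈-++⁺ˡ; ∈-++⁺ʳ; ∈-++⁻; ∈-∃++; ∈-concatMap⁺; ∈-concatMap⁻; ∈-deduplicate⁺; ∈-deduplicate⁻; ∈-map⁺; ∈-map⁻; ∈-cartesianProduct⁺; ∈-allFin)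
open import Data.List.Relation.Unary.Any using (Any; here; there; any?)
import Data.List.Relation.Unary.Any.Properties as AnyP
open import Data.List.Relation.Unary.All using (All; []; _∷_)
import Data.List.Relation.Unary.All as All
open import Data.List.Relation.Unary.AllPairs using (AllPairs; []; _∷_)
import Data.List.Relation.Unary.AllPairs.Properties as AllPairsP
open import Data.List.Relation.Unary.Unique.Propositional using (Unique)
import Data.List.Relation.Unary.Unique.Propositional.Properties as Uniq
open import Data.List.Relation.Binary.Subset.Propositional using (_⊆_)
open import Function using (_∘_; id)
open import Function.Bundles using (_⇔_; mk⇔; Equivalence)
open import Relation.Binary.Definitions using (DecidableEquality; tri<; tri≈; tri>)
open import Relation.Binary.PropositionalEquality
open import Relation.Nullary using (¬_; Dec; yes; no; contradiction; _×-dec_; _⊎-dec_; ¬?)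
open import Relation.Nullary.Decidable using (decidable-stable)
open import Relation.Unary using (Decidable)

-- Lists and finite sums

-- The edges of Z need not belong to G, so all the matroids are taken on K_V(G). One Z serves every
-- M_j, and each M_j pays |Z| once: this is where the division by k comes from. The obstacle is that
-- blocks overlap. If all vertices of a block lie in other blocks, its leaving edges may all belong
-- to F, so connectivity yields no edge outside F for it; moreover, peeling off vertices loses edges
-- of F. A potential pays for both: a cut duplicates at most c vertices while it adds a block, and a
-- peeled vertex costs fewer than 4c edges, so N joins come with overlap at most cN and at most 4c²N
-- lost edges. A block then gains from the edges leaving its private vertices or from its shared
-- vertices, and the weights are balanced so that 2kc² remains per join; edges are counted at both
-- ends, which leaves kc² edges outside F per join. The goal A is the existence of a packing of size
-- at least Σ r_j(K_V(G)). A packing larger than the current one just restarts the search.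

private variable
  A B : Set

unique-∷ : {x : A} {xs : List A} → x ∉ xs → Unique xs → Unique (x ∷ xs)
unique-∷ {xs = xs} x∉ u = All.tabulate (λ y∈ x≡y → x∉ (subst (_∈ xs) (sym x≡y) y∈)) ∷ u

unique-head : {x : A} {xs : List A} → Unique (x ∷ xs) → x ∉ xs
unique-head = Uniq.Unique[x∷xs]⇒x∉xs

unique-tail : {x : A} {xs : List A} → Unique (x ∷ xs) → Unique xs
unique-tail (_ ∷ u) = u

∷-⊆ : {x : A} {xs ys : List A} → x ∈ ys → xs ⊆ ys → (x ∷ xs) ⊆ ys
∷-⊆ x∈ xs⊆ (here refl) = x∈
∷-⊆ x∈ xs⊆ (there z∈)  = xs⊆ z∈

∷-mono-⊆ : {x : A} {xs ys : List A} → xs ⊆ ys → (x ∷ xs) ⊆ (x ∷ ys)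
∷-mono-⊆ xs⊆ = ∷-⊆ (here refl) (there ∘ xs⊆)

unique-⊆⇒length≤ : {xs ys : List A} → Unique xs → xs ⊆ ys → length xs ≤ length ys
unique-⊆⇒length≤ {xs = []} u s = z≤n
unique-⊆⇒length≤ {xs = x ∷ xs} {ys} u s with ∈-∃++ (s (here refl))
... | as , bs , refl = subst (suc (length xs) ≤_) eq (s≤s (unique-⊆⇒length≤ (unique-tail u) sub))
  where
  eq : suc (length (as ++ bs)) ≡ length (as ++ x ∷ bs)
  eq = begin
    suc (length (as ++ bs))       ≡⟨ cong suc (length-++ as) ⟩
    suc (length as + length bs)   ≡⟨ +-suc (length as) (length bs) ⟨
    length as + suc (length bs)   ≡⟨ length-++ as ⟨
    length (as ++ x ∷ bs)         ∎
    where open ≡-Reasoning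
  sub : xs ⊆ (as ++ bs)
  sub {z} z∈ with ∈-++⁻ as (s (there z∈))
  ... | inj₁ z∈as = ∈-++⁺ˡ z∈as
  ... | inj₂ (here refl) = contradiction z∈ (unique-head u)
  ... | inj₂ (there z∈bs) = ∈-++⁺ʳ as z∈bs

search : {P Q : A → Set} (xs : List A) → (∀ {x} → x ∈ xs → P x ⊎ Q x) →
         (∃[ x ] x ∈ xs × P x) ⊎ (∀ {x} → x ∈ xs → Q x)
search [] f = inj₂ λ ()
search (x ∷ xs) f with f (here refl)
... | inj₁ p = inj₁ (x , here refl , p)
... | inj₂ q with search xs (f ∘ there)
... | inj₁ (y , y∈ , p) = inj₁ (y , there y∈ , p)
... | inj₂ g = inj₂ λ { (here refl) → q ; (there y∈) → g y∈ }

searchDec : {P : A → Set} → Decidable P → (xs : List A) →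
            (∃[ x ] x ∈ xs × P x) ⊎ (∀ {x} → x ∈ xs → ¬ P x)
searchDec P? xs = search xs λ {x} _ → case (P? x)
  where
  case : {X : Set} → Dec X → X ⊎ ¬ X
  case (yes p) = inj₁ p
  case (no ¬p) = inj₂ ¬p

private variable
  P Q : A → Set

⊆-filter : (P? : Decidable P) {xs ys : List A} → xs ⊆ ys → (∀ {x} → x ∈ xs → P x) → xs ⊆ filter P? ys
⊆-filter P? s p x∈ = ∈-filter⁺ P? (s x∈) (p x∈)

filter-⊆ : (P? : Decidable P) {xs : List A} → filter P? xs ⊆ xs
filter-⊆ P? x∈ = proj₁ (∈-filter⁻ P? x∈)

filter-holds : (P? : Decidable P) (xs : List A) {x : A} → x ∈ filter P? xs → P x
filter-holds P? xs x∈ = proj₂ (∈-filter⁻ P? {xs = xs} x∈)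

∈-singleton : {x y : A} → x ∈ y ∷ [] → x ≡ y
∈-singleton (here eq) = eq

length≤1⇒≡ : {x y : A} {xs : List A} → length xs ≤ 1 → x ∈ xs → y ∈ xs → x ≡ y
length≤1⇒≡ {xs = _ ∷ []} l (here refl) (here refl) = refl
length≤1⇒≡ {xs = _ ∷ _ ∷ _} (s≤s ()) _ _

take-⊆ : (n : ℕ) {xs : List A} → take n xs ⊆ xs
take-⊆ (suc n) {x ∷ xs} (here refl) = here refl
take-⊆ (suc n) {x ∷ xs} (there z∈)  = there (take-⊆ n z∈)

∑ : (A → ℕ) → List A → ℕ
∑ f []       = 0
∑ f (x ∷ xs) = f x + ∑ f xs

∑-mono : {f g : A → ℕ} (xs : List A) → (∀ {x} → x ∈ xs → f x ≤ g x) → ∑ f xs ≤ ∑ g xs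
∑-mono [] le = z≤n
∑-mono (x ∷ xs) le = +-mono-≤ (le (here refl)) (∑-mono xs (le ∘ there))

∑-cong : {f g : A → ℕ} (xs : List A) → (∀ x → f x ≡ g x) → ∑ f xs ≡ ∑ g xs
∑-cong [] eq = refl
∑-cong (x ∷ xs) eq = cong₂ _+_ (eq x) (∑-cong xs eq)

+-interchange : ∀ a b c d → (a + b) + (c + d) ≡ (a + c) + (b + d)
+-interchange a b c d = begin
  (a + b) + (c + d) ≡⟨ +-assoc a b (c + d) ⟩
  a + (b + (c + d)) ≡⟨ cong (a +_) (+-assoc b c d) ⟨
  a + ((b + c) + d) ≡⟨ cong (λ z → a + (z + d)) (+-comm b c) ⟩
  a + ((c + b) + d) ≡⟨ cong (a +_) (+-assoc c b d) ⟩
  a + (c + (b + d)) ≡⟨ +-assoc a c (b + d) ⟨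
  (a + c) + (b + d) ∎
  where open ≡-Reasoning

∑-+ : (f g : A → ℕ) (xs : List A) → ∑ (λ x → f x + g x) xs ≡ ∑ f xs + ∑ g xs
∑-+ f g [] = refl
∑-+ f g (x ∷ xs) = trans (cong (f x + g x +_) (∑-+ f g xs)) (+-interchange (f x) (g x) (∑ f xs) (∑ g xs))

∑-* : (n : ℕ) (f : A → ℕ) (xs : List A) → ∑ (λ x → n * f x) xs ≡ n * ∑ f xs
∑-* n f [] = sym (*-zeroʳ n)
∑-* n f (x ∷ xs) = trans (cong (n * f x +_) (∑-* n f xs)) (sym (*-distribˡ-+ n (f x) (∑ f xs)))

∑-const : (n : ℕ) (xs : List A) → ∑ (λ _ → n) xs ≡ length xs * n
∑-const n [] = refl
∑-const n (x ∷ xs) = cong (n +_) (∑-const n xs)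

∑-++ : (f : A → ℕ) (xs ys : List A) → ∑ f (xs ++ ys) ≡ ∑ f xs + ∑ f ys
∑-++ f [] ys = refl
∑-++ f (x ∷ xs) ys = trans (cong (f x +_) (∑-++ f xs ys)) (sym (+-assoc (f x) _ _))

∑-swap : (f : A → B → ℕ) (xs : List A) (ys : List B) →
         ∑ (λ x → ∑ (f x) ys) xs ≡ ∑ (λ y → ∑ (λ x → f x y) xs) ys
∑-swap f [] ys = sym (trans (∑-const 0 ys) (*-zeroʳ (length ys)))
∑-swap f (x ∷ xs) ys = trans (cong (∑ (f x) ys +_) (∑-swap f xs ys)) (sym (∑-+ (f x) _ ys))

χ : {X : Set} → Dec X → ℕ
χ (yes _) = 1
χ (no _)  = 0

χ-yes : {X : Set} (d : Dec X) → X → χ d ≡ 1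
χ-yes (yes _) x = refl
χ-yes (no ¬x) x = contradiction x ¬x

χ-no : {X : Set} (d : Dec X) → ¬ X → χ d ≡ 0
χ-no (yes x) ¬x = contradiction x ¬x
χ-no (no _)  ¬x = refl

length-filter≡∑χ : (P? : Decidable P) (xs : List A) → length (filter P? xs) ≡ ∑ (λ x → χ (P? x)) xs
length-filter≡∑χ P? [] = refl
length-filter≡∑χ P? (x ∷ xs) with P? x
... | yes _ = cong suc (length-filter≡∑χ P? xs)
... | no  _ = length-filter≡∑χ P? xs

length-concatMap : (f : A → List B) (xs : List A) → length (concatMap f xs) ≡ ∑ (length ∘ f) xs
length-concatMap f [] = refl
length-concatMap f (x ∷ xs) = trans (length-++ (f x)) (cong (length (f x) +_) (length-concatMap f xs))

module DecList (_≟A_ : DecidableEquality A) where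

  open import Data.List.Membership.DecPropositional _≟A_ public using (_∈?_; _∉?_)
  open import Data.List.Relation.Unary.Unique.DecPropositional.Properties _≟A_ public using (deduplicate-!)

  dedup : List A → List A
  dedup = deduplicate _≟A_

  dedup-! : (xs : List A) → Unique (dedup xs)
  dedup-! = deduplicate-!

  ∈-dedup⁺ : {xs : List A} → xs ⊆ dedup xs
  ∈-dedup⁺ = ∈-deduplicate⁺ _≟A_

  ∈-dedup⁻ : {xs : List A} → dedup xs ⊆ xs
  ∈-dedup⁻ {xs} = ∈-deduplicate⁻ _≟A_ xs

  length-dedup : (xs : List A) → length (dedup xs) ≤ length xs
  length-dedup xs = unique-⊆⇒length≤ (dedup-! xs) ∈-dedup⁻

  missing : {xs ys : List A} → Unique xs → length ys < length xs → ∃[ x ] (x ∈ xs × x ∉ ys)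
  missing {xs} {ys} u lt with searchDec (_∉? ys) xs
  ... | inj₁ r = r
  ... | inj₂ all = contradiction (unique-⊆⇒length≤ u sub) (<⇒≱ lt)
    where
    sub : xs ⊆ ys
    sub {x} x∈ with x ∈? ys
    ... | yes p = p
    ... | no ¬p = contradiction ¬p (all x∈)

  ∉-filter-length : {xs ys : List A} → Unique xs → length xs ≤ length (filter (_∉? ys) xs) + length ys
  ∉-filter-length {xs} {ys} u = subst (length xs ≤_) (length-++ (filter (_∉? ys) xs))
    (unique-⊆⇒length≤ u sub)
    where
    sub : xs ⊆ filter (_∉? ys) xs ++ ys
    sub {x} x∈ with x ∈? ys
    ... | yes p = ∈-++⁺ʳ (filter (_∉? ys) xs) p
    ... | no ¬p = ∈-++⁺ˡ (∈-filter⁺ (_∉? ys) x∈ ¬p)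

-- Reachability and cuts

_≟E_ : DecidableEquality Edge
_≟E_ = ≡-dec _≟_ _≟_

open DecList _≟_
module E = DecList _≟E_

Inside : List ℕ → Edge → Set
Inside X e = proj₁ e ∈ X × proj₂ e ∈ X

inside? : (X : List ℕ) → Decidable (Inside X)
inside? X e = (proj₁ e ∈? X) ×-dec (proj₂ e ∈? X)

inside-mono : ∀ {X Y e} → X ⊆ Y → Inside X e → Inside Y e
inside-mono X⊆Y (a , b) = X⊆Y a , X⊆Y b

Incident : ℕ → Edge → Set
Incident v e = v ≡ proj₁ e ⊎ v ≡ proj₂ e

incident? : (v : ℕ) → Decidable (Incident v)
incident? v e = (v ≟ proj₁ e) ⊎-dec (v ≟ proj₂ e)

Adj : Graph → ℕ → ℕ → Set
Adj G a b = (a , b) ∈ G ⊎ (b , a) ∈ G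

induced : Graph → List ℕ → Graph
induced F X = filter (inside? X) F

∈V⁺ : ∀ {G e v} → e ∈ G → Incident v e → v ∈ V G
∈V⁺ {G} e∈ inc = ∈-concatMap⁺ _ (lose e∈ (member inc))
  where
  member : ∀ {e v} → Incident v e → v ∈ proj₁ e ∷ proj₂ e ∷ []
  member (inj₁ refl) = here refl
  member (inj₂ refl) = there (here refl)

∈V⁻ : ∀ G {v} → v ∈ V G → ∃[ e ] (e ∈ G × Incident v e)
∈V⁻ G v∈ with find (∈-concatMap⁻ (λ e → proj₁ e ∷ proj₂ e ∷ []) {xs = G} v∈)
... | e , e∈ , here eq         = e , e∈ , inj₁ eq
... | e , e∈ , there (here eq) = e , e∈ , inj₂ eq

adj-V : ∀ {G a b} → Adj G a b → a ∈ V G × b ∈ V G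
adj-V (inj₁ e∈) = ∈V⁺ e∈ (inj₁ refl) , ∈V⁺ e∈ (inj₂ refl)
adj-V (inj₂ e∈) = ∈V⁺ e∈ (inj₂ refl) , ∈V⁺ e∈ (inj₁ refl)

V-mono : ∀ {G H} → G ⊆ H → V G ⊆ V H
V-mono {G} G⊆H v∈ with ∈V⁻ G v∈
... | e , e∈ , inc = ∈V⁺ (G⊆H e∈) inc

V-inside : ∀ {G X} → (∀ {e} → e ∈ G → Inside X e) → V G ⊆ X
V-inside {G} ins v∈ with ∈V⁻ G v∈
... | e , e∈ , inj₁ refl = proj₁ (ins e∈)
... | e , e∈ , inj₂ refl = proj₂ (ins e∈)

V-induced : ∀ F {X} → V (induced F X) ⊆ X
V-induced F {X} = V-inside (filter-holds (inside? X) F)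

WF-⊆ : ∀ {G H} → H ⊆ G → WF G → WF H
WF-⊆ H⊆G wf = All.tabulate λ e∈ → All.lookup wf (H⊆G e∈)

reach-trans : ∀ {G S a b c} → Reach G S a b → Reach G S b c → Reach G S a c
reach-trans here r = r
reach-trans (step e a∉ b∉ r) s = step e a∉ b∉ (reach-trans r s)

reach-subset : ∀ {G S S′ u v} → (∀ {a} → a ∈ V G → a ∉ S → a ∉ S′) → Reach G S u v → Reach G S′ u v
reach-subset f here = here
reach-subset f (step e a∉ b∉ r) =
  step e (f (proj₁ (adj-V e)) a∉) (f (proj₂ (adj-V e)) b∉) (reach-subset f r)

connected-mono : ∀ {c c′ G} → c′ ≤ c → Connected c G → Connected c′ G
connected-mono c′≤c ((W , uW , W⊆ , lt) , conn) =
  (W , uW , W⊆ , ≤-<-trans c′≤c lt) , λ X uX l → conn X uX (<-≤-trans l c′≤c)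

record ReachSet (H : Graph) (S : List ℕ) (u : ℕ) : Set where
  field
    R       : List ℕ
    source  : u ∈ R
    avoids  : ∀ {r} → r ∈ R → r ∉ S
    reached : ∀ {r} → r ∈ R → Reach H S u r
    closed  : ∀ {a b} → Adj H a b → a ∈ R → b ∉ S → b ∈ R

reachSet : ∀ H S u → u ∉ S → ReachSet H S u
reachSet H S u u∉S =
  grow (length (u ∷ V H)) (u ∷ []) ([] ∷ []) (λ { (here refl) → here refl })
    (n≤1+n _) (here refl) (λ { (here refl) → u∉S }) (λ { (here refl) → here })
  where
  Leaves : List ℕ → ℕ → ℕ → Set
  Leaves R a b = a ∈ R × b ∉ S × b ∉ R

  leaves? : ∀ R a b → Dec (Leaves R a b)
  leaves? R a b = (a ∈? R) ×-dec ((b ∉? S) ×-dec (b ∉? R))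

  -- The fuel `n` bounds the vertices still to be added, as `R` is duplicate-free in `u ∷ V H`; `u`
  -- is listed separately because it may have no edge in `H`.
  grow : (n : ℕ) (R : List ℕ) → Unique R → R ⊆ (u ∷ V H) → length (u ∷ V H) ≤ length R + n →
         u ∈ R → (∀ {r} → r ∈ R → r ∉ S) → (∀ {r} → r ∈ R → Reach H S u r) → ReachSet H S u
  grow n R uR R⊆ bnd src av rch with
    searchDec (λ e → leaves? R (proj₁ e) (proj₂ e) ⊎-dec leaves? R (proj₂ e) (proj₁ e)) H
  ... | inj₂ none = record { R = R ; source = src ; avoids = av ; reached = rch ; closed = cl }
    where
    cl : ∀ {a b} → Adj H a b → a ∈ R → b ∉ S → b ∈ R
    cl {b = b} adj a∈ b∉S with b ∈? R
    ... | yes b∈ = b∈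
    cl (inj₁ e∈) a∈ b∉S | no b∉ = contradiction (inj₁ (a∈ , b∉S , b∉)) (none e∈)
    cl (inj₂ e∈) a∈ b∉S | no b∉ = contradiction (inj₂ (a∈ , b∉S , b∉)) (none e∈)
  ... | inj₁ (e , e∈ , lv) = extend n bnd (orient lv)
    where
    orient : Leaves R (proj₁ e) (proj₂ e) ⊎ Leaves R (proj₂ e) (proj₁ e) →
             ∃[ a ] ∃[ b ] (Adj H a b × Leaves R a b)
    orient (inj₁ l) = _ , _ , inj₁ e∈ , l
    orient (inj₂ l) = _ , _ , inj₂ e∈ , l
    extend : ∀ n → length (u ∷ V H) ≤ length R + n → ∃[ a ] ∃[ b ] (Adj H a b × Leaves R a b) → ReachSet H S u
    extend n bnd (a , b , adj , a∈ , b∉S , b∉) = continue n bnd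
      where
      u′ : Unique (b ∷ R)
      u′ = unique-∷ b∉ uR
      sub : (b ∷ R) ⊆ (u ∷ V H)
      sub = ∷-⊆ (there (proj₂ (adj-V adj))) R⊆
      continue : ∀ n → length (u ∷ V H) ≤ length R + n → ReachSet H S u
      continue zero bnd = contradiction (unique-⊆⇒length≤ u′ sub)
        (<⇒≱ (s≤s (subst (length (u ∷ V H) ≤_) (+-identityʳ (length R)) bnd)))
      continue (suc n) bnd = grow n (b ∷ R) u′ sub (subst (length (u ∷ V H) ≤_) (+-suc (length R) n) bnd)
        (there src) (λ { (here refl) → b∉S ; (there r∈) → av r∈ })
        (λ { (here refl) → reach-trans (rch a∈) (step adj (av a∈) b∉S here) ; (there r∈) → rch r∈ })

-- Connectivity quantifies over all lists `S`, but in a graph on `X` only the trace of `S` on `X`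
-- matters, and the traces are finitely many sublists of `X`.
searchSubsets : {P Q : List ℕ → Set} → (∀ S → P S ⊎ Q S) → (X : List ℕ) →
                (∃[ S ] P S) ⊎ (∀ T → Q (filter (_∈? T) X))
searchSubsets f [] with f []
... | inj₁ p = inj₁ ([] , p)
... | inj₂ q = inj₂ λ _ → q
searchSubsets {P} {Q} f (x ∷ X) with searchSubsets f X | searchSubsets (λ S → f (x ∷ S)) X
... | inj₁ (S , p) | _ = inj₁ (S , p)
... | inj₂ _ | inj₁ (S , p) = inj₁ (x ∷ S , p)
... | inj₂ q | inj₂ q′ = inj₂ go
  where
  go : ∀ T → Q (filter (_∈? T) (x ∷ X))
  go T with x ∈? T
  ... | yes _ = q′ T
  ... | no _  = q T

-- Both sides keep the separator, so `sizes` allows for counting it twice. The private vertices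
-- `leftmost` and `rightmost` make each side a proper part of `X`; as all their edges stay on their
-- own side, a minimum degree bounds the size of each side from below.
record Cut (c : ℕ) (F : Graph) (X : List ℕ) : Set where
  field
    left right sep : List ℕ
    left-⊆         : left ⊆ X
    right-⊆        : right ⊆ X
    left-unique    : Unique left
    right-unique   : Unique right
    leftmost       : ∃[ u ] (u ∈ X × u ∈ left × u ∉ right)
    rightmost      : ∃[ v ] (v ∈ X × v ∈ right × v ∉ left)
    sizes          : length left + length right ≤ length X + c
    edges          : ∀ {e} → e ∈ F → Inside X e → Inside left e ⊎ Inside right e
    sep-size       : length sep ≤ c
    meet           : ∀ {x} → x ∈ left → x ∈ right → x ∈ sep

overlap-length : {P Q : ℕ → Set} (P? : Decidable P) (Q? : Decidable Q) (xs : List ℕ) {zs : List ℕ} → Unique xs →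
  (∀ {x} → P x → Q x → x ∈ zs) → length (filter P? xs) + length (filter Q? xs) ≤ length xs + length zs
overlap-length P? Q? xs {zs} uxs both = begin
  length (filter P? xs) + length (filter Q? xs) ≤⟨ aux xs ⟩
  length xs + length (filter (λ x → P? x ×-dec Q? x) xs)
    ≤⟨ +-monoʳ-≤ (length xs) (unique-⊆⇒length≤ (Uniq.filter⁺ PQ? uxs) sub) ⟩
  length xs + length zs ∎
  where
  open ≤-Reasoning
  PQ? = λ x → P? x ×-dec Q? x
  sub : filter PQ? xs ⊆ zs
  sub x∈ with filter-holds PQ? xs x∈
  ... | p , q = both p q
  aux : ∀ ys → length (filter P? ys) + length (filter Q? ys) ≤ length ys + length (filter PQ? ys)
  aux [] = z≤n
  aux (y ∷ ys) with P? y | Q? y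
  ... | yes _ | yes _ = s≤s (subst₂ _≤_ (sym (+-suc _ _)) (sym (+-suc _ _)) (s≤s (aux ys)))
  ... | yes _ | no _  = s≤s (aux ys)
  ... | no _  | yes _ = subst (_≤ suc (length ys + length (filter PQ? ys))) (sym (+-suc _ _)) (s≤s (aux ys))
  ... | no _  | no _  = m≤n⇒m≤1+n (aux ys)

cutOrConnected : ∀ c F X → Unique X →
  Cut c F X ⊎ (∀ S → Unique S → length S < c → ∀ u v → u ∈ V (induced F X) → v ∈ V (induced F X) →
               u ∉ S → v ∉ S → Reach (induced F X) S u v)
cutOrConnected c F X uX with searchSubsets {P = λ _ → Cut c F X} {Q = Joined} try X
  where
  H = induced F X
  Joined : List ℕ → Set
  Joined S = length S < c → ∀ {u} → u ∈ X → u ∉ S → ∀ {v} → v ∈ X → v ∉ S → Reach H S u v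
  mkCut : ∀ S → length S < c → ∀ {u} → u ∈ X → (Rs : ReachSet H S u) →
          ∀ {v} → v ∈ X → v ∉ S → v ∉ ReachSet.R Rs → Cut c F X
  mkCut S lt {u} u∈ Rs {v} v∈ v∉S v∉R = record
    { left = filter L? X ; right = filter (_∉? R) X ; sep = S
    ; left-⊆ = filter-⊆ L? ; right-⊆ = filter-⊆ (_∉? R)
    ; left-unique = Uniq.filter⁺ L? uX ; right-unique = Uniq.filter⁺ (_∉? R) uX
    ; leftmost = u , u∈ , ∈-filter⁺ L? u∈ (inj₁ source) , λ u∈r → filter-holds (_∉? R) X u∈r source
    ; rightmost = v , v∈ , ∈-filter⁺ (_∉? R) v∈ v∉R , λ v∈l → [ v∉R , v∉S ]′ (filter-holds L? X v∈l)
    ; sizes = ≤-trans (overlap-length L? (_∉? R) X uX both) (+-monoʳ-≤ (length X) (<⇒≤ lt))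
    ; edges = edge
    ; sep-size = <⇒≤ lt
    ; meet = λ x∈l x∈r → both (filter-holds L? X x∈l) (filter-holds (_∉? R) X x∈r)
    }
    where
    open ReachSet Rs
    L? : Decidable (λ x → x ∈ R ⊎ x ∈ S)
    L? x = (x ∈? R) ⊎-dec (x ∈? S)
    both : ∀ {x} → x ∈ R ⊎ x ∈ S → x ∉ R → x ∈ S
    both (inj₁ x∈R) x∉R = contradiction x∈R x∉R
    both (inj₂ x∈S) _   = x∈S
    nbr : ∀ {a b} → Adj H a b → a ∈ R → b ∈ R ⊎ b ∈ S
    nbr {b = b} adj a∈ with b ∈? S
    ... | yes b∈S = inj₂ b∈S
    ... | no b∉S = inj₁ (closed adj a∈ b∉S)
    edge : ∀ {e} → e ∈ F → Inside X e → Inside (filter L? X) e ⊎ Inside (filter (_∉? R) X) e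
    edge {a , b} e∈ (a∈ , b∈) with a ∈? R | b ∈? R
    ... | yes a∈R | _ = inj₁ (∈-filter⁺ L? a∈ (inj₁ a∈R) ,
                              ∈-filter⁺ L? b∈ (nbr (inj₁ (∈-filter⁺ (inside? X) e∈ (a∈ , b∈))) a∈R))
    ... | no _ | yes b∈R = inj₁ (∈-filter⁺ L? a∈ (nbr (inj₂ (∈-filter⁺ (inside? X) e∈ (a∈ , b∈))) b∈R) ,
                              ∈-filter⁺ L? b∈ (inj₁ b∈R))
    ... | no a∉ | no b∉ = inj₂ (∈-filter⁺ (_∉? R) a∈ a∉ , ∈-filter⁺ (_∉? R) b∈ b∉)
  from : ∀ S → length S < c → ∀ {u} → u ∈ X → Cut c F X ⊎ (u ∉ S → ∀ {v} → v ∈ X → v ∉ S → Reach H S u v)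
  from S lt {u} u∈ with u ∈? S
  ... | yes u∈S = inj₂ λ u∉S → contradiction u∈S u∉S
  ... | no u∉S with reachSet H S u u∉S
  ... | Rs with searchDec (λ v → (v ∉? S) ×-dec (v ∉? ReachSet.R Rs)) X
  ... | inj₁ (v , v∈ , v∉S , v∉R) = inj₁ (mkCut S lt u∈ Rs v∈ v∉S v∉R)
  ... | inj₂ none = inj₂ λ _ {v} v∈ v∉S → ReachSet.reached Rs (inR v∈ v∉S)
    where
    inR : ∀ {v} → v ∈ X → v ∉ S → v ∈ ReachSet.R Rs
    inR {v} v∈ v∉S with v ∈? ReachSet.R Rs
    ... | yes p = p
    ... | no ¬p = contradiction (v∉S , ¬p) (none v∈)
  try : ∀ S → Cut c F X ⊎ Joined S
  try S with length S <? c
  ... | no ≮ = inj₂ λ lt → contradiction lt ≮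
  ... | yes lt with search X (from S lt)
  ... | inj₁ (_ , _ , cut) = inj₁ cut
  ... | inj₂ all = inj₂ λ _ u∈ → all u∈
... | inj₁ (_ , cut) = inj₁ cut
... | inj₂ joined = inj₂ λ S uS lt u v u∈ v∈ u∉S v∉S →
  -- Walks in the induced graph stay in `X`, so avoiding the trace of `S` on `X` amounts to avoiding
  -- `S`.
  reach-subset (λ a∈ a∉S′ a∈S → a∉S′ (∈-filter⁺ (_∈? S) (V-induced F a∈) a∈S))
    (joined S (≤-<-trans (unique-⊆⇒length≤ (Uniq.filter⁺ (_∈? S) uX) (filter-holds (_∈? S) X)) lt)
      (V-induced F u∈) (u∉S ∘ filter-holds (_∈? S) X) (V-induced F v∈) (v∉S ∘ filter-holds (_∈? S) X))

-- Decomposition into connected blocks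

other : ℕ → Edge → ℕ
other v (a , b) with v ≟ a
... | yes _ = b
... | no _  = a

Covered : List (List ℕ) → Edge → Set
Covered 𝒫 e = Any (λ Y → Inside Y e) 𝒫

covered? : ∀ 𝒫 → Decidable (Covered 𝒫)
covered? 𝒫 e = any? (λ Y → inside? Y e) 𝒫

Lost : List ℕ → List (List ℕ) → Edge → Set
Lost X 𝒫 e = Inside X e × ¬ Covered 𝒫 e

lost? : ∀ X 𝒫 → Decidable (Lost X 𝒫)
lost? X 𝒫 e = inside? X e ×-dec ¬? (covered? 𝒫 e)

lost : Graph → List ℕ → List (List ℕ) → Graph
lost F X 𝒫 = filter (lost? X 𝒫) F

Thin : ℕ → List ℕ → List ℕ → Set
Thin c X Y = ∃[ S ] (length S ≤ c × (∀ {x} → x ∈ X → x ∈ Y → x ∈ S))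

-- `spans` excludes isolated vertices: the closure operation fills only `V (induced F Y)`, whereas a
-- block has to be filled on all of `Y`.
record Block (c d : ℕ) (F : Graph) (X Y : List ℕ) : Set where
  field
    ⊆-base    : Y ⊆ X
    uniq      : Unique Y
    large     : d ≤ length Y
    spans     : Y ⊆ V (induced F Y)
    connected : Connected c (induced F Y)

-- In `count`, cutting X along S adds d * length S ≤ d * c on the left and one block on the right;
-- removing a vertex of degree below d loses fewer than d edges and saves d on the right.
record Decomposition (c d : ℕ) (F : Graph) (X : List ℕ) : Set where
  field
    blocks : List (List ℕ)
    block  : ∀ {Y} → Y ∈ blocks → Block c d F X Y
    thin   : AllPairs (Thin c) blocks
    count  : d * ∑ length blocks + length (lost F X blocks) + d * c ≤ d * length X + d * c * length blocks

incidentInside? : ∀ v X → Decidable (λ e → Incident v e × Inside X e)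
incidentInside? v X e = incident? v e ×-dec inside? X e

degree : Graph → List ℕ → ℕ → ℕ
degree F X v = length (filter (incidentInside? v X) F)

mkEdge : ℕ → ℕ → Edge
mkEdge a b with a <? b
... | yes _ = a , b
... | no _  = b , a

incident-mkEdge : ∀ {v a b} → a < b → Incident v (a , b) → ∃[ w ] (Incident w (a , b) × (a , b) ≡ mkEdge v w)
incident-mkEdge {a = a} {b} a<b (inj₁ refl) with a <? b
... | yes _ = b , inj₂ refl , lem
  where
  lem : (a , b) ≡ mkEdge a b
  lem with a <? b
  ... | yes _ = refl
  ... | no ≮ = contradiction a<b ≮
... | no ≮ = contradiction a<b ≮
incident-mkEdge {a = a} {b} a<b (inj₂ refl) = a , inj₁ refl , lem
  where
  lem : (a , b) ≡ mkEdge b a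
  lem with b <? a
  ... | yes b<a = contradiction b<a (<-asym a<b)
  ... | no _ = refl

inside-incident : ∀ {X w e} → Inside X e → Incident w e → w ∈ X
inside-incident (a∈ , b∈) (inj₁ refl) = a∈
inside-incident (a∈ , b∈) (inj₂ refl) = b∈

-- In a simple graph an edge at `v` is determined by its other end, so `mkEdge v` maps `Y` to a list
-- containing all the edges counted.
degree≤length : ∀ {F} → WF F → Unique F → ∀ {X Y v} →
  (∀ {e} → e ∈ F → Inside X e → Incident v e → Inside Y e) → degree F X v ≤ length Y
degree≤length {F} wf uF {X} {Y} {v} f = subst (degree F X v ≤_) (length-map (mkEdge v) Y)
  (unique-⊆⇒length≤ (Uniq.filter⁺ (incidentInside? v X) uF) sub)
  where
  sub : filter (incidentInside? v X) F ⊆ map (mkEdge v) Y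
  sub {e} e∈ with ∈-filter⁻ (incidentInside? v X) {xs = F} e∈
  ... | e∈F , inc , ins with incident-mkEdge (All.lookup wf e∈F) inc
  ... | w , incw , eq = subst (_∈ map (mkEdge v) Y) (sym eq) (∈-map⁺ (mkEdge v) (inside-incident (f e∈F ins inc) incw))

thin-cross : ∀ {c} {𝒫 𝒬 : List (List ℕ)} {Y Z S : List ℕ} → length S ≤ c →
  (∀ {x} → x ∈ Y → x ∈ Z → x ∈ S) → (∀ {P} → P ∈ 𝒫 → P ⊆ Y) → (∀ {Q} → Q ∈ 𝒬 → Q ⊆ Z) →
  All (λ P → All (Thin c P) 𝒬) 𝒫
thin-cross {S = S} l meet P⊆ Q⊆ = All.tabulate λ P∈ → All.tabulate λ Q∈ →
  S , l , λ x∈P x∈Q → meet (P⊆ P∈ x∈P) (Q⊆ Q∈ x∈Q)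

block-widen : ∀ {c d F X X′ Y} → X ⊆ X′ → Block c d F X Y → Block c d F X′ Y
block-widen X⊆ b = record { ⊆-base = X⊆ ∘ ⊆-base ; uniq = uniq ; large = large ; spans = spans ; connected = connected }
  where open Block b

remove-shrinks : ∀ {X v} → Unique X → v ∈ X → length (filter (_∉? (v ∷ [])) X) < length X
remove-shrinks {X} {v} uX v∈ = unique-⊆⇒length≤
  (unique-∷ (λ v∈′ → filter-holds (_∉? (v ∷ [])) X v∈′ (here refl)) (Uniq.filter⁺ (_∉? (v ∷ [])) uX))
  (∷-⊆ v∈ (filter-⊆ (_∉? (v ∷ []))))

module Decompose (c : ℕ) (1≤c : 1 ≤ c) (F : Graph) (wf : WF F) (uF : Unique F) where

  d : ℕ
  d = 4 * c

  private
    c<d : c < d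
    c<d = begin-strict
      c              <⟨ m<m+n c 1≤c ⟩
      c + c          ≤⟨ m≤m+n (c + c) (c + (c + 0)) ⟩
      (c + c) + (c + (c + 0)) ≡⟨ +-assoc c c _ ⟩
      d ∎
      where open ≤-Reasoning

    2c≤d : 2 * c ≤ d
    2c≤d = *-monoˡ-≤ c {2} {4} (s≤s (s≤s z≤n))

    uLost : ∀ X 𝒫 → Unique (lost F X 𝒫)
    uLost X 𝒫 = Uniq.filter⁺ (lost? X 𝒫) uF

  -- The value of `d` comes from here: (2c)² possible lost edges plus `d * c` must not exceed
  -- `d * (2 * c)`, and `d = 4 * c` gives equality.
  discard : ∀ {X} → length X ≡ 2 * c → Decomposition c d F X
  discard {X} len = record { blocks = [] ; block = λ () ; thin = [] ; count = bound }
    where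
    open ≤-Reasoning
    length-cartesian : ∀ (xs ys : List ℕ) → length (cartesianProduct xs ys) ≡ length xs * length ys
    length-cartesian [] ys = refl
    length-cartesian (x ∷ xs) ys =
      trans (length-++ (map (x ,_) ys)) (cong₂ _+_ (length-map (x ,_) ys) (length-cartesian xs ys))
    few : length (lost F X []) ≤ length X * length X
    few = subst (length (lost F X []) ≤_) (length-cartesian X X)
      (unique-⊆⇒length≤ (uLost X []) λ {e} e∈ →
        let ins = proj₁ (filter-holds (lost? X []) F e∈) in ∈-cartesianProduct⁺ (proj₁ ins) (proj₂ ins))
    arith : ∀ c → 4 * c * 0 + 2 * c * (2 * c) + 4 * c * c ≡ 4 * c * (2 * c) + 4 * c * c * 0
    arith = solve-∀
    bound : d * 0 + length (lost F X []) + d * c ≤ d * length X + d * c * 0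
    bound = begin
      d * 0 + length (lost F X []) + d * c ≤⟨ +-monoˡ-≤ (d * c) (+-monoʳ-≤ (d * 0) few) ⟩
      d * 0 + length X * length X + d * c  ≡⟨ cong (λ l → d * 0 + l * l + d * c) len ⟩
      d * 0 + 2 * c * (2 * c) + d * c      ≡⟨ arith c ⟩
      d * (2 * c) + d * c * 0              ≡⟨ cong (λ l → d * l + d * c * 0) len ⟨
      d * length X + d * c * 0 ∎

  peel : ∀ {X v} → Unique X → v ∈ X → degree F X v < d →
         Decomposition c d F (filter (_∉? (v ∷ [])) X) → Decomposition c d F X
  peel {X} {v} uX v∈ low D = record
    { blocks = blocks
    ; block = λ Y∈ → block-widen (filter-⊆ (_∉? (v ∷ []))) (block Y∈)
    ; thin = thin
    ; count = bound }
    where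
    open Decomposition D
    open ≤-Reasoning
    X′ = filter (_∉? (v ∷ [])) X
    keep : ∀ {w} → w ∈ X → v ≢ w → w ∈ X′
    keep w∈ v≢w = ∈-filter⁺ (_∉? (v ∷ [])) w∈ λ { (here refl) → v≢w refl }
    split : lost F X blocks ⊆ lost F X′ blocks ++ filter (incidentInside? v X) F
    split {e} e∈ with ∈-filter⁻ (lost? X blocks) {xs = F} e∈ | incident? v e
    ... | e∈F , ins , _ | yes inc = ∈-++⁺ʳ (lost F X′ blocks) (∈-filter⁺ (incidentInside? v X) e∈F (inc , ins))
    ... | e∈F , (a∈ , b∈) , nc | no ¬inc =
      ∈-++⁺ˡ (∈-filter⁺ (lost? X′ blocks) e∈F ((keep a∈ (¬inc ∘ inj₁) , keep b∈ (¬inc ∘ inj₂)) , nc))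
    lostBound : length (lost F X blocks) ≤ length (lost F X′ blocks) + d
    lostBound = begin
      length (lost F X blocks) ≤⟨ unique-⊆⇒length≤ (uLost X blocks) split ⟩
      length (lost F X′ blocks ++ filter (incidentInside? v X) F) ≡⟨ length-++ (lost F X′ blocks) ⟩
      length (lost F X′ blocks) + degree F X v ≤⟨ +-monoʳ-≤ _ (<⇒≤ low) ⟩
      length (lost F X′ blocks) + d ∎
    ar₁ : ∀ a l d e → a + (l + d) + e ≡ (a + l + e) + d
    ar₁ = solve-∀
    ar₂ : ∀ d x p → d * x + p + d ≡ d * suc x + p
    ar₂ = solve-∀
    bound : d * ∑ length blocks + length (lost F X blocks) + d * c ≤ d * length X + d * c * length blocks
    bound = begin
      d * ∑ length blocks + length (lost F X blocks) + d * c
        ≤⟨ +-monoˡ-≤ (d * c) (+-monoʳ-≤ (d * ∑ length blocks) lostBound) ⟩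
      d * ∑ length blocks + (length (lost F X′ blocks) + d) + d * c
        ≡⟨ ar₁ (d * ∑ length blocks) (length (lost F X′ blocks)) d (d * c) ⟩
      (d * ∑ length blocks + length (lost F X′ blocks) + d * c) + d ≤⟨ +-monoˡ-≤ d count ⟩
      d * length X′ + d * c * length blocks + d ≡⟨ ar₂ d (length X′) (d * c * length blocks) ⟩
      d * suc (length X′) + d * c * length blocks ≤⟨ +-monoˡ-≤ _ (*-monoʳ-≤ d (remove-shrinks uX v∈)) ⟩
      d * length X + d * c * length blocks ∎

  -- Adding the counts of the sides gives `d * c` twice on the left: one copy pays for the separator
  -- lying on both sides, the other is kept as the invariant. Blocks from different sides meet only
  -- in `sep`.
  split : ∀ {X} (cut : Cut c F X) → Decomposition c d F (Cut.left cut) →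
          Decomposition c d F (Cut.right cut) → Decomposition c d F X
  split {X} cut D₁ D₂ = record
    { blocks = 𝒫₁ ++ 𝒫₂
    ; block = λ Y∈ → [ (λ Y∈₁ → block-widen left-⊆ (D₁.block Y∈₁)) , (λ Y∈₂ → block-widen right-⊆ (D₂.block Y∈₂)) ]′
                     (∈-++⁻ 𝒫₁ Y∈)
    ; thin = AllPairsP.++⁺ D₁.thin D₂.thin
        (thin-cross sep-size meet (Block.⊆-base ∘ D₁.block) (Block.⊆-base ∘ D₂.block))
    ; count = bound }
    where
    open Cut cut
    open ≤-Reasoning
    module D₁ = Decomposition D₁
    module D₂ = Decomposition D₂
    𝒫₁ = D₁.blocks
    𝒫₂ = D₂.blocks
    ℓ₁ = length (lost F left 𝒫₁)
    ℓ₂ = length (lost F right 𝒫₂)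
    sub : lost F X (𝒫₁ ++ 𝒫₂) ⊆ lost F left 𝒫₁ ++ lost F right 𝒫₂
    sub {e} e∈ with ∈-filter⁻ (lost? X (𝒫₁ ++ 𝒫₂)) {xs = F} e∈
    ... | e∈F , ins , nc with edges e∈F ins
    ... | inj₁ l = ∈-++⁺ˡ (∈-filter⁺ (lost? left 𝒫₁) e∈F (l , nc ∘ AnyP.++⁺ˡ))
    ... | inj₂ r = ∈-++⁺ʳ (lost F left 𝒫₁) (∈-filter⁺ (lost? right 𝒫₂) e∈F (r , nc ∘ AnyP.++⁺ʳ 𝒫₁))
    lostBound : length (lost F X (𝒫₁ ++ 𝒫₂)) ≤ ℓ₁ + ℓ₂
    lostBound = subst (length (lost F X (𝒫₁ ++ 𝒫₂)) ≤_) (length-++ (lost F left 𝒫₁))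
      (unique-⊆⇒length≤ (uLost X (𝒫₁ ++ 𝒫₂)) sub)
    s₁ = ∑ length 𝒫₁
    s₂ = ∑ length 𝒫₂
    ar₁ : ∀ d s₁ s₂ ℓ₁ ℓ₂ e → d * (s₁ + s₂) + (ℓ₁ + ℓ₂) + e + e ≡ (d * s₁ + ℓ₁ + e) + (d * s₂ + ℓ₂ + e)
    ar₁ = solve-∀
    ar₂ : ∀ d l r e p q → (d * l + e * p) + (d * r + e * q) ≡ d * (l + r) + e * (p + q)
    ar₂ = solve-∀
    ar₃ : ∀ d x c z → d * (x + c) + z ≡ d * x + z + d * c
    ar₃ = solve-∀
    bound′ : d * ∑ length (𝒫₁ ++ 𝒫₂) + length (lost F X (𝒫₁ ++ 𝒫₂)) + d * c + d * c
             ≤ d * length X + d * c * length (𝒫₁ ++ 𝒫₂) + d * c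
    bound′ = begin
      d * ∑ length (𝒫₁ ++ 𝒫₂) + length (lost F X (𝒫₁ ++ 𝒫₂)) + d * c + d * c
        ≤⟨ +-monoˡ-≤ (d * c) (+-monoˡ-≤ (d * c) (+-monoʳ-≤ (d * ∑ length (𝒫₁ ++ 𝒫₂)) lostBound)) ⟩
      d * ∑ length (𝒫₁ ++ 𝒫₂) + (ℓ₁ + ℓ₂) + d * c + d * c
        ≡⟨ cong (λ s → d * s + (ℓ₁ + ℓ₂) + d * c + d * c) (∑-++ length 𝒫₁ 𝒫₂) ⟩
      d * (s₁ + s₂) + (ℓ₁ + ℓ₂) + d * c + d * c ≡⟨ ar₁ d s₁ s₂ ℓ₁ ℓ₂ (d * c) ⟩
      (d * s₁ + ℓ₁ + d * c) + (d * s₂ + ℓ₂ + d * c) ≤⟨ +-mono-≤ D₁.count D₂.count ⟩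
      (d * length left + d * c * length 𝒫₁) + (d * length right + d * c * length 𝒫₂)
        ≡⟨ ar₂ d (length left) (length right) (d * c) (length 𝒫₁) (length 𝒫₂) ⟩
      d * (length left + length right) + d * c * (length 𝒫₁ + length 𝒫₂)
        ≤⟨ +-monoˡ-≤ _ (*-monoʳ-≤ d sizes) ⟩
      d * (length X + c) + d * c * (length 𝒫₁ + length 𝒫₂)
        ≡⟨ cong (λ p → d * (length X + c) + d * c * p) (length-++ 𝒫₁) ⟨
      d * (length X + c) + d * c * length (𝒫₁ ++ 𝒫₂) ≡⟨ ar₃ d (length X) c (d * c * length (𝒫₁ ++ 𝒫₂)) ⟩
      d * length X + d * c * length (𝒫₁ ++ 𝒫₂) + d * c ∎
    bound = +-cancelʳ-≤ (d * c) _ _ bound′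

  single : ∀ {X} → Block c d F X X → Decomposition c d F X
  single {X} b = record
    { blocks = X ∷ []
    ; block = λ { (here refl) → b }
    ; thin = [] ∷ []
    ; count = bound }
    where
    none : length (lost F X (X ∷ [])) ≤ 0
    none = unique-⊆⇒length≤ {ys = []} (uLost X (X ∷ [])) λ e∈ →
      let ins , nc = filter-holds (lost? X (X ∷ [])) F e∈ in contradiction (here ins) nc
    open ≤-Reasoning
    ar : ∀ d x e → d * (x + 0) + 0 + e ≡ d * x + e * 1
    ar = solve-∀
    bound : d * (length X + 0) + length (lost F X (X ∷ [])) + d * c ≤ d * length X + d * c * 1
    bound = begin
      d * (length X + 0) + length (lost F X (X ∷ [])) + d * c
        ≤⟨ +-monoˡ-≤ (d * c) (+-monoʳ-≤ (d * (length X + 0)) none) ⟩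
      d * (length X + 0) + 0 + d * c ≡⟨ ar d (length X) (d * c) ⟩
      d * length X + d * c * 1 ∎

  -- The minimum degree supplies what the reachability clause lacks: more than `c` vertices, and an
  -- edge of the induced graph at every vertex of `X`.
  highDegree⇒block : ∀ {X} → Unique X → 0 < length X → (∀ {v} → v ∈ X → d ≤ degree F X v) →
    (∀ S → Unique S → length S < c → ∀ u v → u ∈ V (induced F X) → v ∈ V (induced F X) →
       u ∉ S → v ∉ S → Reach (induced F X) S u v) → Block c d F X X
  highDegree⇒block {X} uX pos high conn = record
    { ⊆-base = id ; uniq = uX ; large = big pos high ; spans = spans
    ; connected = (X , uX , spans , <-≤-trans c<d (big pos high)) , conn }
    where
    big : 0 < length X → (∀ {v} → v ∈ X → d ≤ degree F X v) → d ≤ length X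
    big pos high with missing {ys = []} uX pos
    ... | x , x∈ , _ = ≤-trans (high x∈) (degree≤length wf uF λ _ ins _ → ins)
    spans : X ⊆ V (induced F X)
    spans {v} v∈ with filter (incidentInside? v X) F in eq | high v∈
    ... | [] | d≤0 = contradiction (<-≤-trans c<d d≤0) λ ()
    ... | e ∷ es | _ with ∈-filter⁻ (incidentInside? v X) {xs = F} (subst (e ∈_) (sym eq) (here refl))
    ... | e∈ , inc , ins = ∈V⁺ (∈-filter⁺ (inside? X) e∈ ins) inc

  -- The bound `2 * c` survives every step: vertices are peeled only above it, and cuts are made
  -- only when all degrees are at least `d`, which gives both sides at least `d` vertices.
  decompose : ∀ n X → Unique X → length X ≤ n → 2 * c ≤ length X → Decomposition c d F X
  decompose zero X uX l≤ ≥2c = contradiction (≤-trans (≤-trans 1≤c (m≤m+n c (c + 0))) (≤-trans ≥2c l≤)) λ ()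
  decompose (suc n) X uX l≤ ≥2c with length X ≟ 2 * c
  ... | yes eq = discard eq
  ... | no ≢ with searchDec (λ v → degree F X v <? d) X
  ... | inj₁ (v , v∈ , low) = peel uX v∈ low
    (decompose n _ (Uniq.filter⁺ (_∉? (v ∷ [])) uX)
      (s≤s⁻¹ (≤-trans (remove-shrinks uX v∈) l≤))
      (s≤s⁻¹ (≤-trans (≤∧≢⇒< ≥2c (≢ ∘ sym)) (subst (length X ≤_) (+-comm _ 1) (∉-filter-length {ys = v ∷ []} uX)))))
  ... | inj₂ high with cutOrConnected c F X uX
  ... | inj₂ conn = single (highDegree⇒block uX (≤-trans (≤-trans 1≤c (m≤m+n c (c + 0))) ≥2c) (≮⇒≥ ∘ high) conn)
  ... | inj₁ cut = split cut
    (decompose n left left-unique (s≤s⁻¹ (≤-trans lessˡ l≤)) (≤-trans 2c≤d bigˡ))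
    (decompose n right right-unique (s≤s⁻¹ (≤-trans lessʳ l≤)) (≤-trans 2c≤d bigʳ))
    where
    open Cut cut
    lessˡ : length left < length X
    lessˡ with rightmost
    ... | v , v∈X , v∈r , v∉l = unique-⊆⇒length≤ (unique-∷ v∉l left-unique) (∷-⊆ v∈X left-⊆)
    lessʳ : length right < length X
    lessʳ with leftmost
    ... | u , u∈X , u∈l , u∉r = unique-⊆⇒length≤ (unique-∷ u∉r right-unique) (∷-⊆ u∈X right-⊆)
    bigˡ : d ≤ length left
    bigˡ with leftmost
    ... | u , u∈X , u∈l , u∉r = ≤-trans (≮⇒≥ (high u∈X)) (degree≤length wf uF λ e∈ ins inc →
      [ id , (λ r → contradiction (inside-incident r inc) u∉r) ]′ (edges e∈ ins))
    bigʳ : d ≤ length right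
    bigʳ with rightmost
    ... | v , v∈X , v∈r , v∉l = ≤-trans (≮⇒≥ (high v∈X)) (degree≤length wf uF λ e∈ ins inc →
      [ (λ l → contradiction (inside-incident l inc) v∉l) , id ]′ (edges e∈ ins))

-- Joining complete graphs

∈K⁺ : ∀ {X u v} → u ∈ X → v ∈ X → u < v → (u , v) ∈ K X
∈K⁺ {X} {u} {v} u∈ v∈ u<v = ∈-concatMap⁺ _ (lose u∈ (∈-concatMap⁺ _ (lose v∈ kept)))
  where
  kept : (u , v) ∈ (if u <ᵇ v then (u , v) ∷ [] else [])
  kept with u <ᵇ v | <⇒<ᵇ u<v
  ... | true | _ = here refl

∈K⁻ : ∀ X {e} → e ∈ K X → Inside X e × proj₁ e < proj₂ e
∈K⁻ X {e} e∈ with find (∈-concatMap⁻ (λ u → concatMap (λ v → if u <ᵇ v then (u , v) ∷ [] else []) X) {xs = X} e∈)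
... | u , u∈ , e∈u with find (∈-concatMap⁻ (λ v → if u <ᵇ v then (u , v) ∷ [] else []) {xs = X} e∈u)
... | v , v∈ , e∈uv with u <ᵇ v | <ᵇ⇒< u v
∈K⁻ X e∈ | u , u∈ , e∈u | v , v∈ , here refl | true | lt = (u∈ , v∈) , lt _

WF-K : ∀ X → WF (K X)
WF-K X = All.tabulate λ e∈ → proj₂ (∈K⁻ X e∈)

V-K : ∀ {X} → V (K X) ⊆ X
V-K {X} = V-inside (proj₁ ∘ ∈K⁻ X)

adj-K : ∀ {X u v} → u ∈ X → v ∈ X → u ≢ v → Adj (K X) u v
adj-K {u = u} {v} u∈ v∈ u≢v with <-cmp u v
... | tri< u<v _ _ = inj₁ (∈K⁺ u∈ v∈ u<v)
... | tri≈ _ u≡v _ = contradiction u≡v u≢v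
... | tri> _ _ v<u = inj₂ (∈K⁺ v∈ u∈ v<u)

adj-⊆ : ∀ {G H a b} → G ⊆ H → Adj G a b → Adj H a b
adj-⊆ G⊆H (inj₁ e∈) = inj₁ (G⊆H e∈)
adj-⊆ G⊆H (inj₂ e∈) = inj₂ (G⊆H e∈)

⊆V-K : ∀ {X} → Unique X → 1 < length X → X ⊆ V (K X)
⊆V-K uX lt {x} x∈ with missing {ys = x ∷ []} uX lt
... | y , y∈ , y∉ = proj₁ (adj-V (adj-K x∈ y∈ λ { refl → y∉ (here refl) }))

Full : (Edge → Set) → List ℕ → Set
Full Sp X = ∀ {u v} → u ∈ X → v ∈ X → u < v → Sp (u , v)

-- The only property of matroid closure that the graph theory uses. `U` keeps `H` inside the
-- complete graph on which the matroids are taken.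
FillClosed : ℕ → List ℕ → (Edge → Set) → Set
FillClosed c U Sp = ∀ H → WF H → V H ⊆ U → Connected c H → (∀ {e} → e ∈ H → Sp e) → Full Sp (V H)

link : ℕ → ℕ → List Edge
link a b with <-cmp a b
... | tri< _ _ _ = (a , b) ∷ []
... | tri≈ _ _ _ = []
... | tri> _ _ _ = (b , a) ∷ []

-- All pairs between at most `c` vertices of either side: fewer than `c` deletions leave a chosen
-- vertex on each side that is not deleted entirely. A vertex chosen on both sides is its own
-- bridge.
links : ℕ → List ℕ → List ℕ → List Edge
links c Y X = concatMap (λ a → concatMap (link a) (take c X)) (take c Y)

link-adj : ∀ {a b} → a ≢ b → Adj (link a b) a b
link-adj {a} {b} a≢b with <-cmp a b
... | tri< _ _ _ = inj₁ (here refl)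
... | tri≈ _ a≡b _ = contradiction a≡b a≢b
... | tri> _ _ _ = inj₂ (here refl)

link-edge : ∀ {a b e} → e ∈ link a b → proj₁ e < proj₂ e × Inside (a ∷ b ∷ []) e
link-edge {a} {b} e∈ with <-cmp a b
link-edge (here refl) | tri< a<b _ _ = a<b , here refl , there (here refl)
link-edge (here refl) | tri> _ _ b<a = b<a , there (here refl) , here refl

length-link : ∀ a b → length (link a b) ≤ 1
length-link a b with <-cmp a b
... | tri< _ _ _ = ≤-refl
... | tri≈ _ _ _ = z≤n
... | tri> _ _ _ = ≤-refl

links-adj : ∀ {c Y X a b} → a ∈ take c Y → b ∈ take c X → a ≢ b → Adj (links c Y X) a b
links-adj {c} {Y} {X} {a} a∈ b∈ a≢b = adj-⊆ inner (link-adj a≢b)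
  where
  inner : link a _ ⊆ links c Y X
  inner e∈ = ∈-concatMap⁺ (λ a → concatMap (link a) (take c X)) {xs = take c Y}
               (lose a∈ (∈-concatMap⁺ (link a) (lose b∈ e∈)))

links-edge : ∀ {c Y X e} → e ∈ links c Y X → proj₁ e < proj₂ e × Inside (Y ++ X) e
links-edge {c} {Y} {X} e∈ with find (∈-concatMap⁻ (λ a → concatMap (link a) (take c X)) {xs = take c Y} e∈)
... | a , a∈ , e∈a with find (∈-concatMap⁻ (link a) {xs = take c X} e∈a)
... | b , b∈ , e∈ab with link-edge {a} {b} e∈ab
... | lt , ins = lt , inside-mono (∷-⊆ (∈-++⁺ˡ (take-⊆ c a∈)) (∷-⊆ (∈-++⁺ʳ Y (take-⊆ c b∈)) λ ())) ins

length-take≤ : ∀ c (X : List ℕ) → length (take c X) ≤ c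
length-take≤ c X = subst (_≤ c) (sym (length-take c X)) (m⊓n≤m c (length X))

length-links : ∀ c Y X → length (links c Y X) ≤ c * c
length-links c Y X = begin
  length (links c Y X) ≡⟨ length-concatMap _ (take c Y) ⟩
  ∑ (λ a → length (concatMap (link a) (take c X))) (take c Y) ≤⟨ ∑-mono (take c Y) (λ {a} _ → row a) ⟩
  ∑ (λ _ → c) (take c Y) ≡⟨ ∑-const c (take c Y) ⟩
  length (take c Y) * c ≤⟨ *-monoˡ-≤ c (length-take≤ c Y) ⟩
  c * c ∎
  where
  open ≤-Reasoning
  row : ∀ a → length (concatMap (link a) (take c X)) ≤ c
  row a = begin
    length (concatMap (link a) (take c X)) ≡⟨ length-concatMap (link a) (take c X) ⟩
    ∑ (λ b → length (link a b)) (take c X) ≤⟨ ∑-mono (take c X) (λ {b} _ → length-link a b) ⟩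
    ∑ (λ _ → 1) (take c X) ≡⟨ ∑-const 1 (take c X) ⟩
    length (take c X) * 1 ≡⟨ *-identityʳ _ ⟩
    length (take c X) ≤⟨ length-take≤ c X ⟩
    c ∎

survivor : ∀ {c Y S p} → Unique Y → length S < c → p ∈ Y → p ∉ S → ∃[ a ] (a ∈ take c Y × a ∉ S)
survivor {c} {Y} {S} {p} uY lt p∈ p∉ with c ≤? length Y
... | yes c≤ = missing (Uniq.take⁺ c uY) (subst (length S <_) (sym (trans (length-take c Y) (m≤n⇒m⊓n≡m c≤))) lt)
... | no c≰ = p , subst (p ∈_) (sym (take-all c Y (<⇒≤ (≰⇒> c≰)))) p∈ , p∉

module Merge (c : ℕ) (1≤c : 1 ≤ c) {U Y X : List ℕ} (uY : Unique Y) (uX : Unique X) (Y⊆ : Y ⊆ U) (X⊆ : X ⊆ U) where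

  H : Graph
  H = K Y ++ (K X ++ links c Y X)

  private
    KY⊆ : K Y ⊆ H
    KY⊆ = ∈-++⁺ˡ
    KX⊆ : K X ⊆ H
    KX⊆ = ∈-++⁺ʳ (K Y) ∘ ∈-++⁺ˡ
    L⊆ : links c Y X ⊆ H
    L⊆ = ∈-++⁺ʳ (K Y) ∘ ∈-++⁺ʳ (K X)

    elim : ∀ {Z : Edge → Set} → (∀ {e} → e ∈ K Y → Z e) → (∀ {e} → e ∈ K X → Z e) →
           (∀ {e} → e ∈ links c Y X → Z e) → ∀ {e} → e ∈ H → Z e
    elim f g h e∈ = [ f , (λ e∈′ → [ g , h ]′ (∈-++⁻ (K X) e∈′)) ]′ (∈-++⁻ (K Y) e∈)

  H-WF : WF H
  H-WF = All.tabulate (elim (proj₂ ∘ ∈K⁻ Y) (proj₂ ∘ ∈K⁻ X) (proj₁ ∘ links-edge {c} {Y} {X}))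

  V-H : V H ⊆ Y ++ X
  V-H = V-inside (elim (inside-mono ∈-++⁺ˡ ∘ proj₁ ∘ ∈K⁻ Y) (inside-mono (∈-++⁺ʳ Y) ∘ proj₁ ∘ ∈K⁻ X)
                       (proj₂ ∘ links-edge {c} {Y} {X}))

  private
    within : ∀ {Z S p q} → K Z ⊆ H → p ∈ Z → q ∈ Z → p ∉ S → q ∉ S → Reach H S p q
    within {p = p} {q} sub p∈ q∈ p∉ q∉ with p ≟ q
    ... | yes refl = here
    ... | no p≢q = step (adj-⊆ sub (adj-K p∈ q∈ p≢q)) p∉ q∉ here

    bridge : ∀ {S a b} → a ∈ take c Y → b ∈ take c X → a ∉ S → b ∉ S → Reach H S a b × Reach H S b a
    bridge {a = a} {b} a∈ b∈ a∉ b∉ with a ≟ b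
    ... | yes refl = here , here
    ... | no a≢b = step adj a∉ b∉ here , step (swap adj) b∉ a∉ here
      where adj = adj-⊆ L⊆ (links-adj {c} {Y} {X} a∈ b∈ a≢b)

  H-reach : ∀ S → length S < c → ∀ {p q} → p ∈ Y ++ X → q ∈ Y ++ X → p ∉ S → q ∉ S → Reach H S p q
  H-reach S lt {p} {q} p∈ q∈ p∉ q∉ with ∈-++⁻ Y p∈ | ∈-++⁻ Y q∈
  ... | inj₁ p∈Y | inj₁ q∈Y = within KY⊆ p∈Y q∈Y p∉ q∉
  ... | inj₂ p∈X | inj₂ q∈X = within KX⊆ p∈X q∈X p∉ q∉
  ... | inj₁ p∈Y | inj₂ q∈X with survivor uY lt p∈Y p∉ | survivor uX lt q∈X q∉
  ... | a , a∈ , a∉ | b , b∈ , b∉ = reach-trans (within KY⊆ p∈Y (take-⊆ c a∈) p∉ a∉)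
    (reach-trans (proj₁ (bridge a∈ b∈ a∉ b∉)) (within KX⊆ (take-⊆ c b∈) q∈X b∉ q∉))
  H-reach S lt {p} {q} p∈ q∈ p∉ q∉ | inj₂ p∈X | inj₁ q∈Y with survivor uY lt q∈Y q∉ | survivor uX lt p∈X p∉
  ... | a , a∈ , a∉ | b , b∈ , b∉ = reach-trans (within KX⊆ p∈X (take-⊆ c b∈) p∉ b∉)
    (reach-trans (proj₂ (bridge a∈ b∈ a∉ b∉)) (within KY⊆ (take-⊆ c a∈) q∈Y a∉ q∉))

  H-connected : c < length Y ⊎ c < length X → Connected c H
  H-connected big = size big , λ S _ lt u v u∈ v∈ → H-reach S lt (V-H u∈) (V-H v∈)
    where
    size : c < length Y ⊎ c < length X → ∃[ W ] (Unique W × W ⊆ V H × c < length W)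
    size (inj₁ l) = Y , uY , V-mono KY⊆ ∘ ⊆V-K uY (≤-<-trans 1≤c l) , l
    size (inj₂ l) = X , uX , V-mono KX⊆ ∘ ⊆V-K uX (≤-<-trans 1≤c l) , l

  private
    first : ∀ {Z : List ℕ} {z : ℕ} → z ∈ Z → ∃[ a ] (a ∈ take c Z)
    first {a ∷ Z} _ = go c 1≤c
      where
      go : ∀ c → 1 ≤ c → ∃[ b ] (b ∈ take c (a ∷ Z))
      go (suc c) _ = a , here refl

    -- `V H` lists endpoints only. If `Y` is a single vertex, `K Y` is empty and the vertex enters
    -- `H` through a link, which is a genuine edge because `u ∉ X`.
    ends-in-V : ∀ {u v} → u ∈ Y → v ∈ X → u ∉ X → v ∉ Y → u ∈ V H × v ∈ V H
    ends-in-V {u} {v} u∈ v∈ u∉ v∉ with first u∈ | first v∈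
    ... | a , a∈ | b , b∈ = lhs , rhs
      where
      lhs : u ∈ V H
      lhs with u ≟ a
      ... | yes refl = proj₁ (adj-V (adj-⊆ L⊆ (links-adj {c} {Y} {X} a∈ b∈ λ { refl → u∉ (take-⊆ c b∈) })))
      ... | no u≢a = proj₁ (adj-V (adj-⊆ KY⊆ (adj-K u∈ (take-⊆ c a∈) u≢a)))
      rhs : v ∈ V H
      rhs with v ≟ b
      ... | yes refl = proj₂ (adj-V (adj-⊆ L⊆ (links-adj {c} {Y} {X} a∈ b∈ λ { refl → v∉ (take-⊆ c a∈) })))
      ... | no v≢b = proj₁ (adj-V (adj-⊆ KX⊆ (adj-K v∈ (take-⊆ c b∈) v≢b)))

  module _ {Sp : Edge → Set} (fc : FillClosed c U Sp) (fY : Full Sp Y) (fX : Full Sp X)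
           (fL : ∀ {e} → e ∈ links c Y X → Sp e) where

    private
      H-full : c < length Y ⊎ c < length X → Full Sp (V H)
      H-full big = fc H H-WF ([ Y⊆ , X⊆ ]′ ∘ ∈-++⁻ Y ∘ V-H) (H-connected big)
        (elim (λ e∈ → let (a , b) , lt = ∈K⁻ Y e∈ in fY a b lt) (λ e∈ → let (a , b) , lt = ∈K⁻ X e∈ in fX a b lt) fL)

      cross : ∀ {u v} → u ∈ Y → v ∈ X → u ∉ X → v ∉ Y → (u < v → Sp (u , v)) × (v < u → Sp (v , u))
      cross {u} {v} u∈ v∈ u∉ v∉ with c <? length Y | c <? length X
      ... | yes l | _ = let u∈V , v∈V = ends-in-V u∈ v∈ u∉ v∉ in H-full (inj₁ l) u∈V v∈V , H-full (inj₁ l) v∈V u∈V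
      ... | no _ | yes l = let u∈V , v∈V = ends-in-V u∈ v∈ u∉ v∉ in H-full (inj₂ l) u∈V v∈V , H-full (inj₂ l) v∈V u∈V
      -- Here `H` may have too few vertices to be `c`-connected, but both sides are taken whole by
      -- `take c`, so the edge itself is a link.
      ... | no Y≯ | no X≯ with links-adj {c} {Y} {X} (whole Y≯ u∈) (whole X≯ v∈) (λ { refl → u∉ v∈ })
        where
        whole : ∀ {Z z} → ¬ c < length Z → z ∈ Z → z ∈ take c Z
        whole {Z} {z} ≯ z∈ = subst (z ∈_) (sym (take-all c Z (≮⇒≥ ≯))) z∈
      ... | inj₁ e∈ = (λ _ → fL e∈) , λ v<u → contradiction v<u (<-asym (proj₁ (links-edge {c} {Y} {X} e∈)))
      ... | inj₂ e∈ = (λ u<v → contradiction u<v (<-asym (proj₁ (links-edge {c} {Y} {X} e∈)))) , λ _ → fL e∈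

    merge-full : Full Sp (Y ++ X)
    merge-full {u} {v} u∈ v∈ u<v with u ∈? Y | v ∈? Y | u ∈? X | v ∈? X
    ... | yes u∈Y | yes v∈Y | _ | _ = fY u∈Y v∈Y u<v
    ... | _ | _ | yes u∈X | yes v∈X = fX u∈X v∈X u<v
    ... | yes u∈Y | no v∉Y | no u∉X | yes v∈X = proj₁ (cross u∈Y v∈X u∉X v∉Y) u<v
    ... | no u∉Y | yes v∈Y | yes u∈X | no v∉X = proj₂ (cross v∈Y u∈X v∉X u∉Y) u<v
    ... | no u∉Y | _ | no u∉X | _ = contradiction (∈-++⁻ Y u∈) [ u∉Y , u∉X ]′
    ... | _ | no v∉Y | _ | no v∉X = contradiction (∈-++⁻ Y v∈) [ v∉Y , v∉X ]′

joinAll : ℕ → List ℕ → List (List ℕ) → List Edge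
joinAll c Y [] = []
joinAll c Y (X ∷ Xs) = links c Y X ++ joinAll c (dedup (Y ++ X)) Xs

length-joinAll : ∀ c Y Xs → length (joinAll c Y Xs) ≤ length Xs * (c * c)
length-joinAll c Y [] = z≤n
length-joinAll c Y (X ∷ Xs) = subst (_≤ c * c + length Xs * (c * c)) (sym (length-++ (links c Y X)))
  (+-mono-≤ (length-links c Y X) (length-joinAll c (dedup (Y ++ X)) Xs))

joinAll-full : ∀ c → 1 ≤ c → ∀ {U} {Sp : Edge → Set} → FillClosed c U Sp → ∀ {Y Xs} → Unique Y → Y ⊆ U → Full Sp Y →
  (∀ {X} → X ∈ Xs → Unique X × X ⊆ U × Full Sp X) → (∀ {e} → e ∈ joinAll c Y Xs → Sp e) →
  ∀ {Z} → (∀ {z} → z ∈ Z → z ∈ Y ⊎ Any (z ∈_) Xs) → Full Sp Z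
joinAll-full c 1≤c fc {Y} {[]} uY Y⊆ fY fXs fJ cov u∈ v∈ = fY (only (cov u∈)) (only (cov v∈))
  where
  only : ∀ {z} → z ∈ Y ⊎ Any (z ∈_) [] → z ∈ Y
  only (inj₁ z∈) = z∈
joinAll-full c 1≤c fc {Y} {X ∷ Xs} uY Y⊆ fY fXs fJ cov with fXs (here refl)
... | uX , X⊆ , fX = joinAll-full c 1≤c fc (dedup-! (Y ++ X)) ([ Y⊆ , X⊆ ]′ ∘ ∈-++⁻ Y ∘ ∈-dedup⁻)
  (λ u∈ v∈ → Merge.merge-full c 1≤c uY uX Y⊆ X⊆ fc fY fX (fJ ∘ ∈-++⁺ˡ) (∈-dedup⁻ u∈) (∈-dedup⁻ v∈))
  (fXs ∘ there) (fJ ∘ ∈-++⁺ʳ (links c Y X)) (λ z∈ → move (cov z∈))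
  where
  move : ∀ {z} → z ∈ Y ⊎ Any (z ∈_) (X ∷ Xs) → z ∈ dedup (Y ++ X) ⊎ Any (z ∈_) Xs
  move (inj₁ z∈) = inj₁ (∈-dedup⁺ (∈-++⁺ˡ z∈))
  move (inj₂ (here z∈)) = inj₁ (∈-dedup⁺ (∈-++⁺ʳ Y z∈))
  move (inj₂ (there z∈)) = inj₂ z∈

-- Repairing an edge subset of a highly connected graph

∑-filter : {A : Set} {P : A → Set} (P? : Decidable P) (f : A → ℕ) (xs : List A) →
           ∑ f (filter P? xs) ≡ ∑ (λ x → χ (P? x) * f x) xs
∑-filter P? f [] = refl
∑-filter P? f (x ∷ xs) with P? x
... | yes _ = cong₂ _+_ (sym (+-identityʳ (f x))) (∑-filter P? f xs)
... | no _  = ∑-filter P? f xs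

-- With d = 4c, the weights α = degreeWeight and W = threshold satisfy W - 2αc - 2dc = 2kc².
degreeWeight : ℕ → ℕ → ℕ
degreeWeight k c = (k + 4) * c

threshold : ℕ → ℕ → ℕ
threshold k c = degreeWeight k c * (4 * c)

connectivity : ℕ → ℕ → ℕ
connectivity k c = 2 * threshold k c + c

-- `N` is the number of joins, `E` the overlap of the blocks, `ℓ` the number of lost edges, `r` the
-- size of `R`, and `m` the number of edges of G outside F. From `potential` and `cover`, E ≤ cN and
-- ℓ ≤ dcN. Then WN ≤ 2αE + 2r ≤ (2αc + 2dc)N + 2m, and the surplus 2kc² per join gives the bound.
count-bound : ∀ k c {n p q s E ℓ r m N} → 1 ≤ c → p + q ≡ suc N →
  threshold k c * (p + q) ≤ 2 * degreeWeight k c * E + 2 * r + threshold k c →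
  r ≤ m + ℓ →
  4 * c * s + ℓ + 4 * c * c ≤ 4 * c * n + 4 * c * c * p →
  n + E ≤ s + q →
  k * (N * (c * c)) ≤ m
count-bound k c {n} {p} {q} {s} {E} {ℓ} {r} {m} {N} 1≤c N≡ gains r≤ potential cover =
  *-cancelˡ-≤ 2 (+-cancelˡ-≤ ((2 * k + 16) * (N * (c * c))) _ _ total)
  where
  open ≤-Reasoning
  d = 4 * c
  α = degreeWeight k c
  W = threshold k c
  excess : d * E + ℓ ≤ d * (c * N)
  excess = +-cancelʳ-≤ (d * n + d * c) _ _ (begin
    (d * E + ℓ) + (d * n + d * c) ≡⟨ a₁ d E ℓ n c ⟩
    d * (n + E) + (ℓ + d * c)     ≤⟨ +-monoˡ-≤ (ℓ + d * c) (*-monoʳ-≤ d cover) ⟩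
    d * (s + q) + (ℓ + d * c)     ≡⟨ a₂ d s q ℓ c ⟩
    (d * s + ℓ + d * c) + d * q   ≤⟨ +-monoˡ-≤ (d * q) potential ⟩
    -- As `d ≤ d * c`, an uncovered vertex can be charged like a block, so that only the number
    -- `p + q` of pieces matters.
    (d * n + d * c * p) + d * q   ≤⟨ +-monoʳ-≤ (d * n + d * c * p) (*-monoˡ-≤ q (m≤m*n d c {{>-nonZero 1≤c}})) ⟩
    (d * n + d * c * p) + d * c * q ≡⟨ a₃ d n c p q ⟩
    d * n + d * c * (p + q)       ≡⟨ cong (λ z → d * n + d * c * z) N≡ ⟩
    d * n + d * c * suc N         ≡⟨ a₄ d n c N ⟩
    d * (c * N) + (d * n + d * c) ∎)
    where
    a₁ : ∀ d E ℓ n c → (d * E + ℓ) + (d * n + d * c) ≡ d * (n + E) + (ℓ + d * c)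
    a₁ = solve-∀
    a₂ : ∀ d s q ℓ c → d * (s + q) + (ℓ + d * c) ≡ (d * s + ℓ + d * c) + d * q
    a₂ = solve-∀
    a₃ : ∀ d n c p q → (d * n + d * c * p) + d * c * q ≡ d * n + d * c * (p + q)
    a₃ = solve-∀
    a₄ : ∀ d n c N → d * n + d * c * suc N ≡ d * (c * N) + (d * n + d * c)
    a₄ = solve-∀
  E≤ : E ≤ c * N
  E≤ = *-cancelˡ-≤ d {{>-nonZero (≤-trans 1≤c (m≤m+n c (c + (c + (c + 0)))))}} (≤-trans (m≤m+n (d * E) ℓ) excess)
  ℓ≤ : ℓ ≤ d * (c * N)
  ℓ≤ = ≤-trans (m≤n+m ℓ (d * E)) excess
  gains′ : W * N ≤ 2 * α * E + 2 * r
  gains′ = +-cancelʳ-≤ W _ _ (begin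
    W * N + W ≡⟨ a₁ W N ⟩
    W * suc N ≡⟨ cong (W *_) N≡ ⟨
    W * (p + q) ≤⟨ gains ⟩
    2 * α * E + 2 * r + W ∎)
    where
    a₁ : ∀ W N → W * N + W ≡ W * suc N
    a₁ = solve-∀
  total : (2 * k + 16) * (N * (c * c)) + 2 * (k * (N * (c * c))) ≤ (2 * k + 16) * (N * (c * c)) + 2 * m
  total = begin
    (2 * k + 16) * (N * (c * c)) + 2 * (k * (N * (c * c))) ≡⟨ a₁ k c N ⟩
    W * N ≤⟨ gains′ ⟩
    2 * α * E + 2 * r ≤⟨ +-mono-≤ (*-monoʳ-≤ (2 * α) E≤) (*-monoʳ-≤ 2 (≤-trans r≤ (+-monoʳ-≤ m ℓ≤))) ⟩
    2 * α * (c * N) + 2 * (m + d * (c * N)) ≡⟨ a₂ k c N m ⟩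
    (2 * k + 16) * (N * (c * c)) + 2 * m ∎
    where
    a₁ : ∀ k c N → (2 * k + 16) * (N * (c * c)) + 2 * (k * (N * (c * c))) ≡ (k + 4) * c * (4 * c) * N
    a₁ = solve-∀
    a₂ : ∀ k c N m → 2 * ((k + 4) * c) * (c * N) + 2 * (m + 4 * c * (c * N)) ≡ (2 * k + 16) * (N * (c * c)) + 2 * m
    a₂ = solve-∀

other-endpoint : ∀ {a b e} → e ≡ (a , b) ⊎ e ≡ (b , a) → Incident a e × other a e ≡ b
other-endpoint {a} {b} (inj₁ refl) with a ≟ a
... | yes _ = inj₁ refl , refl
... | no a≢a = contradiction refl a≢a
other-endpoint {a} {b} (inj₂ refl) with a ≟ b
... | yes refl = inj₁ refl , refl
... | no _ = inj₂ refl , refl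

-- The factor 2 stems from m ≤ 2(m - 1) for m ≥ 2: a shared vertex is paid for by its overlap alone.
-- A vertex in at most one block is charged its degree `δ` at most once, through its block or as an
-- uncovered vertex.
charge : ∀ {α m φ δ} {X : Set} (X? : Dec X) → (2 ≤ m → φ ≡ α) → (¬ 2 ≤ m → φ ≡ δ) → (X → m ≡ 0) →
         m * φ + χ X? * δ ≤ 2 * α * (m ∸ 1) + δ
charge {α} {zero} {δ = δ} (yes _) _ _ _ = ≤-reflexive (trans (+-identityʳ δ) (cong (_+ δ) (sym (*-zeroʳ (2 * α)))))
charge {m = zero} (no _) _ _ _ = z≤n
charge {m = suc m} (yes x) _ _ x⇒ = contradiction (x⇒ x) λ ()
charge {α} {suc zero} {φ} {δ} (no _) _ lo _ = begin
  φ + 0 + 0 ≡⟨ trans (+-identityʳ _) (+-identityʳ _) ⟩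
  φ ≡⟨ lo (λ { (s≤s ()) }) ⟩
  δ ≤⟨ m≤n+m δ _ ⟩
  2 * α * 0 + δ ∎
  where open ≤-Reasoning
charge {α} {suc (suc m)} {φ} {δ} (no _) hi _ _ = begin
  suc (suc m) * φ + 0 ≡⟨ cong (λ z → suc (suc m) * z + 0) (hi (s≤s (s≤s z≤n))) ⟩
  suc (suc m) * α + 0 ≤⟨ m≤m+n _ (m * α) ⟩
  suc (suc m) * α + 0 + m * α ≡⟨ ar m α ⟩
  2 * α * suc m ≤⟨ m≤m+n _ δ ⟩
  2 * α * suc m + δ ∎
  where
  open ≤-Reasoning
  ar : ∀ m α → suc (suc m) * α + 0 + m * α ≡ 2 * α * suc m
  ar = solve-∀

-- `Z` is chosen before `Sp`, since the same edges must serve all `k` matroids.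
RepairSet : ℕ → ℕ → Graph → Graph → Set₁
RepairSet k c G F = Σ (List Edge) λ Z →
  k * length Z ≤ length (filter (E._∉? F) (E.dedup G)) ×
  (∀ {Sp : Edge → Set} → FillClosed c (V G) Sp → (∀ {e} → e ∈ F → Sp e) → (∀ {e} → e ∈ Z → Sp e) → Full Sp (V G))

module Repair (k c : ℕ) (1≤c : 1 ≤ c) (G : Graph) (wf : WF G) (F : Graph) (F⊆G : F ⊆ G)
              (conn : Connected (connectivity k c) G) (D : Decomposition c (4 * c) F (dedup (V G))) where

  C W α d : ℕ
  C = connectivity k c
  W = threshold k c
  α = degreeWeight k c
  d = 4 * c

  U : List ℕ
  U = dedup (V G)

  G₀ : Graph
  G₀ = E.dedup G

  private
    uU : Unique U
    uU = dedup-! (V G)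

    1≤α : 1 ≤ α
    1≤α = *-mono-≤ {1} {k + 4} {1} {c} (≤-trans (s≤s z≤n) (m≤n+m 4 k)) 1≤c

    W≤C : W ≤ C
    W≤C = ≤-trans (m≤m+n W (W + 0)) (m≤m+n (2 * W) c)

    C<U : C < length U
    C<U with proj₁ conn
    ... | X , uX , X⊆ , lt = <-≤-trans lt (unique-⊆⇒length≤ uX (∈-dedup⁺ ∘ X⊆))

    edge-U : ∀ {e} → e ∈ G → Inside U e
    edge-U e∈ = ∈-dedup⁺ (∈V⁺ e∈ (inj₁ refl)) , ∈-dedup⁺ (∈V⁺ e∈ (inj₂ refl))

  open Decomposition D

  Uncovered : ℕ → Set
  Uncovered v = ¬ Any (v ∈_) blocks

  uncovered? : Decidable Uncovered
  uncovered? v = ¬? (any? (v ∈?_) blocks)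

  rest : List ℕ
  rest = filter uncovered? U

  mult : ℕ → ℕ
  mult v = length (filter (v ∈?_) blocks)

  private
    Kept : Edge → Set
    Kept e = e ∈ F × Covered blocks e

    notKept? : Decidable (¬_ ∘ Kept)
    notKept? e = ¬? ((e E.∈? F) ×-dec covered? blocks e)

  -- The edges of G outside F, together with the edges of F inside no block. Thus every edge of G
  -- whose ends share no block is counted, and the surplus is only the lost edges.
  R : Graph
  R = filter notKept? G₀

  degR : ℕ → ℕ
  degR v = length (filter (incident? v) R)

  length-R : length R ≤ length (filter (E._∉? F) G₀) + length (lost F U blocks)
  length-R = subst (length R ≤_) (length-++ (filter (E._∉? F) G₀))
    (unique-⊆⇒length≤ (Uniq.filter⁺ notKept? (E.dedup-! G)) sub)
    where
    sub : R ⊆ filter (E._∉? F) G₀ ++ lost F U blocks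
    sub {e} e∈ with ∈-filter⁻ notKept? {xs = G₀} e∈ | e E.∈? F
    ... | e∈G , nk | yes e∈F = ∈-++⁺ʳ (filter (E._∉? F) G₀)
          (∈-filter⁺ (lost? U blocks) e∈F (edge-U (F⊆G e∈F) , λ cov → nk (e∈F , cov)))
    ... | e∈G , nk | no e∉F = ∈-++⁺ˡ (∈-filter⁺ (E._∉? F) e∈G e∉F)

  -- Walks from `u` that avoid `S` never leave `X`; as `S` is too small to separate G, everything
  -- outside `X` lies in `S`.
  separated : ∀ {X S u} → u ∈ X → u ∈ V G → u ∉ S → length S < C →
    (∀ {a b} → Adj G a b → a ∈ X → a ∉ S → b ∉ S → b ∈ X) → length (filter (_∉? X) U) ≤ length S
  separated {X} {S} {u} u∈X u∈V u∉S lt closed = unique-⊆⇒length≤ (Uniq.filter⁺ (_∉? X) uU) sub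
    where
    S′ = dedup S
    stay : ∀ {a w} → Reach G S′ a w → a ∈ X → w ∈ X
    stay here a∈ = a∈
    stay (step adj a∉ b∉ r) a∈ = stay r (closed adj a∈ (a∉ ∘ ∈-dedup⁺) (b∉ ∘ ∈-dedup⁺))
    sub : filter (_∉? X) U ⊆ S
    sub {w} w∈ with w ∈? S | ∈-filter⁻ (_∉? X) {xs = U} w∈
    ... | yes w∈S | _ = w∈S
    ... | no w∉S | w∈U , w∉X = contradiction
      (stay (proj₂ conn S′ (dedup-! S) (≤-<-trans (length-dedup S) lt) u w u∈V (∈-dedup⁻ w∈U)
               (u∉S ∘ ∈-dedup⁻) (w∉S ∘ ∈-dedup⁻)) u∈X) w∉X

  private
    nbrs : ℕ → List ℕ
    nbrs v = map (other v) (filter (incident? v) R)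

    outer : List ℕ → ℕ → List ℕ
    outer X v = filter (_∉? X) (nbrs v)

    length-outer : ∀ X v → length (outer X v) ≤ degR v
    length-outer X v = ≤-trans (length-filter (_∉? X) (nbrs v))
      (≤-reflexive (length-map (other v) (filter (incident? v) R)))

    outer⁺ : ∀ {X a b} → Adj G a b → b ∉ X → (∀ {Y} → Y ∈ blocks → a ∈ Y → b ∉ Y) → b ∈ outer X a
    outer⁺ {X} {a} {b} adj b∉ sep = ∈-filter⁺ (_∉? X) (viaEdge (oriented adj)) b∉
      where
      oriented : ∀ {a b} → Adj G a b → ∃[ e ] (e ∈ G × (e ≡ (a , b) ⊎ e ≡ (b , a)))
      oriented (inj₁ e∈) = _ , e∈ , inj₁ refl
      oriented (inj₂ e∈) = _ , e∈ , inj₂ refl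
      uncov : ∀ {e} → e ≡ (a , b) ⊎ e ≡ (b , a) → ¬ Kept e
      uncov eq (_ , cov) with find cov
      uncov (inj₁ refl) _ | Y , Y∈ , a∈ , b∈ = sep Y∈ a∈ b∈
      uncov (inj₂ refl) _ | Y , Y∈ , b∈ , a∈ = sep Y∈ a∈ b∈
      viaEdge : ∃[ e ] (e ∈ G × (e ≡ (a , b) ⊎ e ≡ (b , a))) → b ∈ nbrs a
      viaEdge (e , e∈ , eq) with other-endpoint eq
      ... | inc , o≡ = subst (_∈ nbrs a) o≡
        (∈-map⁺ (other a) (∈-filter⁺ (incident? a) (∈-filter⁺ notKept? (E.∈-dedup⁺ e∈) (uncov eq)) inc))

  -- All edges of G at `v` lie in `R`. If they were fewer than `W`, their other ends would have to
  -- include all remaining vertices, of which there are at least `C ≥ W`.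
  rest-gain : ∀ {v} → v ∈ rest → W ≤ degR v
  rest-gain {v} v∈ with W ≤? degR v
  ... | yes W≤ = W≤
  ... | no W≰ = contradiction (≤-trans U-large (≤-trans few (length-outer (v ∷ []) v))) (<⇒≱ (<-≤-trans (≰⇒> W≰) W≤C))
    where
    v∈U = proj₁ (∈-filter⁻ uncovered? {xs = U} v∈)
    unc = filter-holds uncovered? U v∈
    few : length (filter (_∉? (v ∷ [])) U) ≤ length (outer (v ∷ []) v)
    few = separated (here refl) (∈-dedup⁻ v∈U) (λ v∈o → filter-holds (_∉? (v ∷ [])) (nbrs v) v∈o (here refl))
      (≤-<-trans (length-outer (v ∷ []) v) (<-≤-trans (≰⇒> W≰) W≤C)) closed
      where
      closed : ∀ {a b} → Adj G a b → a ∈ v ∷ [] → a ∉ outer (v ∷ []) v → b ∉ outer (v ∷ []) v → b ∈ v ∷ []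
      closed {b = b} adj (here refl) _ b∉ with b ∈? (v ∷ [])
      ... | yes b∈ = b∈
      ... | no b∉v = contradiction (outer⁺ adj b∉v λ Y∈ a∈ _ → unc (lose Y∈ a∈)) b∉
    U-large : C ≤ length (filter (_∉? (v ∷ [])) U)
    U-large = s≤s⁻¹ (≤-trans C<U (subst (length U ≤_) (+-comm _ 1) (∉-filter-length {ys = v ∷ []} uU)))

  -- As α * d = W, a block of at least d vertices, all of them shared, still gains W.
  φ : ℕ → ℕ
  φ v with 2 ≤? mult v
  ... | yes _ = α
  ... | no _  = degR v

  φ-shared : ∀ {v} → 2 ≤ mult v → φ v ≡ α
  φ-shared {v} sh with 2 ≤? mult v
  ... | yes _ = refl
  ... | no ¬sh = contradiction sh ¬sh

  φ-private : ∀ {v} → ¬ 2 ≤ mult v → φ v ≡ degR v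
  φ-private {v} ¬sh with 2 ≤? mult v
  ... | yes sh = contradiction sh ¬sh
  ... | no _ = refl

  gain : List ℕ → ℕ
  gain X = ∑ (λ v → χ (v ∈? X) * φ v) U

  length≤∑χ : ∀ {X} → Unique X → X ⊆ U → length X ≤ ∑ (λ v → χ (v ∈? X)) U
  length≤∑χ {X} uX X⊆ = subst (length X ≤_) (length-filter≡∑χ (_∈? X) U)
    (unique-⊆⇒length≤ uX (⊆-filter (_∈? X) X⊆ id))

  -- If `X` has a private vertex `u`, then `u` is cut off from the outside by the shared vertices of
  -- `X` and the outer `R`-neighbours of its private ones. The gain bounds their number, so a gain
  -- below `W` would contradict connectivity, as at least `W` vertices lie outside `X`.
  block-gain : ∀ {X} → X ∈ blocks → W ≤ length (filter (_∉? X) U) → W ≤ gain X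
  block-gain {X} X∈ co with searchDec (λ v → ¬? (2 ≤? mult v)) X
  ... | inj₂ shared = begin
    α * d ≤⟨ *-monoʳ-≤ α large ⟩
    α * length X ≤⟨ *-monoʳ-≤ α (length≤∑χ uniq ⊆-base) ⟩
    α * ∑ (λ v → χ (v ∈? X)) U ≡⟨ ∑-* α _ U ⟨
    ∑ (λ v → α * χ (v ∈? X)) U ≤⟨ ∑-mono U (λ {v} _ → pointwise v) ⟩
    gain X ∎
    where
    open Block (block X∈)
    open ≤-Reasoning
    pointwise : ∀ v → α * χ (v ∈? X) ≤ χ (v ∈? X) * φ v
    pointwise v with v ∈? X
    ... | no _ = ≤-reflexive (*-zeroʳ α)
    ... | yes v∈ = ≤-reflexive (trans (*-identityʳ α) (sym (trans (+-identityʳ (φ v))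
      (φ-shared (decidable-stable (2 ≤? mult v) (shared v∈))))))
  ... | inj₁ (u , u∈ , u-private) with W ≤? gain X
  ... | yes W≤ = W≤
  ... | no W≰ = contradiction (≤-trans co (separated u∈ (∈-dedup⁻ (Block.⊆-base (block X∈) u∈)) u∉S
                  (≤-<-trans length-S (<-≤-trans (≰⇒> W≰) W≤C)) closed))
                (<⇒≱ (≤-<-trans length-S (≰⇒> W≰)))
    where
    barrier : ℕ → List ℕ
    barrier v with v ∈? X | 2 ≤? mult v
    ... | no _  | _     = []
    ... | yes _ | yes _ = v ∷ []
    ... | yes _ | no _  = outer X v
    S = concatMap barrier U
    length-barrier : ∀ v → length (barrier v) ≤ χ (v ∈? X) * φ v
    length-barrier v with v ∈? X | 2 ≤? mult v
    ... | no _  | _     = z≤n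
    ... | yes _ | yes _ = ≤-trans 1≤α (≤-reflexive (sym (+-identityʳ α)))
    ... | yes _ | no _  = ≤-trans (length-outer X v) (≤-reflexive (sym (+-identityʳ (degR v))))
    length-S : length S ≤ gain X
    length-S = ≤-trans (≤-reflexive (length-concatMap barrier U)) (∑-mono U (λ {v} _ → length-barrier v))
    barrier⁻ : ∀ {s} v → s ∈ barrier v → 2 ≤ mult s ⊎ s ∉ X
    barrier⁻ v s∈ with v ∈? X | 2 ≤? mult v
    barrier⁻ v (here refl) | yes _ | yes sh = inj₁ sh
    barrier⁻ v s∈ | yes _ | no _ = inj₂ (filter-holds (_∉? X) (nbrs v) s∈)
    u∉S : u ∉ S
    u∉S u∈S with find (∈-concatMap⁻ barrier {xs = U} u∈S)
    ... | v , _ , u∈b = [ u-private , (λ u∉ → u∉ u∈) ]′ (barrier⁻ v u∈b)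
    inS : ∀ {s v} → v ∈ X → s ∈ barrier v → s ∈ S
    inS v∈ s∈ = ∈-concatMap⁺ barrier (lose (Block.⊆-base (block X∈) v∈) s∈)
    shared-barrier : ∀ {v} → v ∈ X → 2 ≤ mult v → v ∈ barrier v
    shared-barrier {v} v∈ sh with v ∈? X | 2 ≤? mult v
    ... | no v∉ | _ = contradiction v∈ v∉
    ... | yes _ | yes _ = here refl
    ... | yes _ | no ¬sh = contradiction sh ¬sh
    private-barrier : ∀ {v s} → v ∈ X → ¬ 2 ≤ mult v → s ∈ outer X v → s ∈ barrier v
    private-barrier {v} v∈ ¬sh s∈ with v ∈? X | 2 ≤? mult v
    ... | no v∉ | _ = contradiction v∈ v∉
    ... | yes _ | yes sh = contradiction sh ¬sh
    ... | yes _ | no _ = s∈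
    closed : ∀ {a b} → Adj G a b → a ∈ X → a ∉ S → b ∉ S → b ∈ X
    closed {a} {b} adj a∈ a∉S b∉S with b ∈? X | 2 ≤? mult a
    ... | yes b∈ | _ = b∈
    ... | no _ | yes sh = contradiction (inS a∈ (shared-barrier a∈ sh)) a∉S
    -- `X` is the only block containing `a`, so no block contains both ends and the edge belongs to
    -- `R`.
    ... | no b∉ | no ¬sh = contradiction (inS a∈ (private-barrier a∈ ¬sh (outer⁺ adj b∉ sep))) b∉S
      where
      sep : ∀ {Y} → Y ∈ blocks → a ∈ Y → b ∉ Y
      sep {Y} Y∈ a∈Y b∈Y = b∉ (subst (b ∈_) (length≤1⇒≡ (s≤s⁻¹ (≰⇒> ¬sh))
        (∈-filter⁺ (a ∈?_) Y∈ a∈Y) (∈-filter⁺ (a ∈?_) X∈ a∈)) b∈Y)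

  -- Two thin blocks cannot both have a small complement, so at most one block gains nothing.
  blocks-gain : ∀ Bs → (∀ {X} → X ∈ Bs → X ∈ blocks) → AllPairs (Thin c) Bs → W * length Bs ≤ ∑ gain Bs + W
  blocks-gain [] _ _ = ≤-trans (≤-reflexive (*-zeroʳ W)) z≤n
  blocks-gain (X ∷ Bs) sub (thinX ∷ thins) with W ≤? length (filter (_∉? X) U)
  ... | yes co = begin
    W * suc (length Bs) ≡⟨ *-suc W (length Bs) ⟩
    W + W * length Bs ≤⟨ +-mono-≤ (block-gain (sub (here refl)) co) (blocks-gain Bs (sub ∘ there) thins) ⟩
    gain X + (∑ gain Bs + W) ≡⟨ +-assoc (gain X) _ _ ⟨
    gain X + ∑ gain Bs + W ∎
    where open ≤-Reasoning
  ... | no small = begin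
    W * suc (length Bs) ≡⟨ *-suc W (length Bs) ⟩
    W + W * length Bs ≡⟨ +-comm W _ ⟩
    W * length Bs + W ≡⟨ cong (_+ W) (trans (*-comm W (length Bs)) (sym (∑-const W Bs))) ⟩
    ∑ (λ _ → W) Bs + W ≤⟨ +-monoˡ-≤ W (∑-mono Bs (λ Y∈ → block-gain (sub (there Y∈)) (co (All.lookup thinX Y∈)))) ⟩
    ∑ gain Bs + W ≤⟨ +-monoˡ-≤ W (m≤n+m _ (gain X)) ⟩
    gain X + ∑ gain Bs + W ∎
    where
    open ≤-Reasoning
    co : ∀ {Y} → Thin c X Y → W ≤ length (filter (_∉? Y) U)
    -- The value of `C` comes from here: two complements below `W` and an overlap of at most `c`
    -- would leave at most `2 * W + c` vertices in all.
    co {Y} (S , lS , meet) = ≮⇒≥ λ small′ → <⇒≱ C<U (begin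
      length U ≤⟨ unique-⊆⇒length≤ uU cov ⟩
      length (coX ++ coY ++ S) ≡⟨ length-++ coX ⟩
      length coX + length (coY ++ S) ≡⟨ cong (length coX +_) (length-++ coY) ⟩
      length coX + (length coY + length S) ≤⟨ +-mono-≤ (<⇒≤ (≰⇒> small)) (+-mono-≤ (<⇒≤ small′) lS) ⟩
      W + (W + c) ≡⟨ +-assoc W W c ⟨
      W + W + c ≡⟨ cong (λ w → W + w + c) (+-identityʳ W) ⟨
      C ∎)
      where
      coX = filter (_∉? X) U
      coY = filter (_∉? Y) U
      cov : U ⊆ coX ++ coY ++ S
      cov {x} x∈ with x ∈? X | x ∈? Y
      ... | no x∉ | _ = ∈-++⁺ˡ (∈-filter⁺ (_∉? X) x∈ x∉)
      ... | yes _ | no x∉ = ∈-++⁺ʳ coX (∈-++⁺ˡ (∈-filter⁺ (_∉? Y) x∈ x∉))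
      ... | yes x∈X | yes x∈Y = ∈-++⁺ʳ coX (∈-++⁺ʳ coY (meet x∈X x∈Y))

  -- By truncation an uncovered vertex contributes 0 instead of -1; `rest` makes up for this in
  -- `cover-size`.
  excess : ℕ
  excess = ∑ (λ v → mult v ∸ 1) U

  mult≡∑χ : ∀ v → mult v ≡ ∑ (λ X → χ (v ∈? X)) blocks
  mult≡∑χ v = length-filter≡∑χ (v ∈?_) blocks

  uncovered⇒mult≡0 : ∀ {v} → Uncovered v → mult v ≡ 0
  uncovered⇒mult≡0 {v} unc = n≤0⇒n≡0 (none (filter (v ∈?_) blocks) (λ X∈ → ∈-filter⁻ (v ∈?_) {xs = blocks} X∈))
    where
    none : ∀ Xs → (∀ {X} → X ∈ Xs → X ∈ blocks × v ∈ X) → length Xs ≤ 0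
    none [] _ = z≤n
    none (X ∷ Xs) f = contradiction (lose (proj₁ (f (here refl))) (proj₂ (f (here refl)))) unc

  mult≡0⇒uncovered : ∀ {v} → mult v ≡ 0 → Uncovered v
  mult≡0⇒uncovered {v} eq cov with find cov
  ... | X , X∈ , v∈ with filter (v ∈?_) blocks | ∈-filter⁺ (v ∈?_) X∈ v∈
  mult≡0⇒uncovered {v} () cov | X , X∈ , v∈ | _ ∷ _ | _

  ∑-gain : ∑ gain blocks ≡ ∑ (λ v → mult v * φ v) U
  ∑-gain = trans (∑-swap (λ X v → χ (v ∈? X) * φ v) blocks U) (∑-cong U λ v →
    trans (∑-cong blocks λ X → *-comm (χ (v ∈? X)) (φ v))
      (trans (∑-* (φ v) (λ X → χ (v ∈? X)) blocks)
        (trans (*-comm (φ v) _) (cong (_* φ v) (sym (mult≡∑χ v))))))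

  ∑-degR : ∑ degR U ≤ 2 * length R
  ∑-degR = begin
    ∑ degR U ≡⟨ ∑-cong U (λ v → length-filter≡∑χ (incident? v) R) ⟩
    ∑ (λ v → ∑ (λ e → χ (incident? v e)) R) U ≡⟨ ∑-swap (λ v e → χ (incident? v e)) U R ⟩
    ∑ (λ e → ∑ (λ v → χ (incident? v e)) U) R ≤⟨ ∑-mono R (λ {e} _ → two e) ⟩
    ∑ (λ _ → 2) R ≡⟨ ∑-const 2 R ⟩
    length R * 2 ≡⟨ *-comm (length R) 2 ⟩
    2 * length R ∎
    where
    open ≤-Reasoning
    two : ∀ e → ∑ (λ v → χ (incident? v e)) U ≤ 2
    two e = subst (_≤ 2) (length-filter≡∑χ (λ v → incident? v e) U)
      (unique-⊆⇒length≤ {ys = proj₁ e ∷ proj₂ e ∷ []} (Uniq.filter⁺ (λ v → incident? v e) uU) ends)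
      where
      ends : filter (λ v → incident? v e) U ⊆ proj₁ e ∷ proj₂ e ∷ []
      ends v∈ with filter-holds (λ v → incident? v e) U v∈
      ... | inj₁ refl = here refl
      ... | inj₂ refl = there (here refl)

  -- The gains are summed by vertices instead of by blocks, and the degrees by edges of `R`. The
  -- last `W` allows for the one block that may gain nothing.
  total-gain : W * (length blocks + length rest) ≤ 2 * α * excess + 2 * length R + W
  total-gain = begin
    W * (length blocks + length rest) ≡⟨ *-distribˡ-+ W (length blocks) (length rest) ⟩
    W * length blocks + W * length rest ≤⟨ +-mono-≤ (blocks-gain blocks id thin) rest-sum ⟩
    (∑ gain blocks + W) + ∑ degR rest ≡⟨ ar (∑ gain blocks) W (∑ degR rest) ⟩
    (∑ gain blocks + ∑ degR rest) + W ≡⟨ cong (_+ W) (cong₂ _+_ ∑-gain (∑-filter uncovered? degR U)) ⟩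
    (∑ (λ v → mult v * φ v) U + ∑ (λ v → χ (uncovered? v) * degR v) U) + W ≡⟨ cong (_+ W) (∑-+ _ _ U) ⟨
    ∑ (λ v → mult v * φ v + χ (uncovered? v) * degR v) U + W
      ≤⟨ +-monoˡ-≤ W (∑-mono U (λ {v} _ → charge (uncovered? v) φ-shared φ-private uncovered⇒mult≡0)) ⟩
    ∑ (λ v → 2 * α * (mult v ∸ 1) + degR v) U + W ≡⟨ cong (_+ W) (∑-+ _ degR U) ⟩
    ∑ (λ v → 2 * α * (mult v ∸ 1)) U + ∑ degR U + W
      ≡⟨ cong (λ z → z + ∑ degR U + W) (∑-* (2 * α) (λ v → mult v ∸ 1) U) ⟩
    2 * α * excess + ∑ degR U + W ≤⟨ +-monoˡ-≤ W (+-monoʳ-≤ (2 * α * excess) ∑-degR) ⟩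
    2 * α * excess + 2 * length R + W ∎
    where
    open ≤-Reasoning
    ar : ∀ a w b → (a + w) + b ≡ (a + b) + w
    ar = solve-∀
    rest-sum : W * length rest ≤ ∑ degR rest
    rest-sum = subst (_≤ ∑ degR rest) (trans (∑-const W rest) (*-comm (length rest) W)) (∑-mono rest rest-gain)

  cover-size : length U + excess ≤ ∑ length blocks + length rest
  cover-size = begin
    length U + excess ≡⟨ cong (_+ excess) (trans (∑-const 1 U) (*-identityʳ (length U))) ⟨
    ∑ (λ _ → 1) U + excess ≡⟨ ∑-+ (λ _ → 1) (λ v → mult v ∸ 1) U ⟨
    ∑ (λ v → 1 + (mult v ∸ 1)) U ≤⟨ ∑-mono U (λ {v} _ → pointwise (uncovered? v) mult≡0⇒uncovered) ⟩
    ∑ (λ v → mult v + χ (uncovered? v)) U ≡⟨ ∑-+ mult (χ ∘ uncovered?) U ⟩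
    ∑ mult U + ∑ (χ ∘ uncovered?) U ≡⟨ cong (∑ mult U +_) (length-filter≡∑χ uncovered? U) ⟨
    ∑ mult U + length rest ≤⟨ +-monoˡ-≤ (length rest) ∑-mult ⟩
    ∑ length blocks + length rest ∎
    where
    open ≤-Reasoning
    pointwise : ∀ {m} {X : Set} (X? : Dec X) → (m ≡ 0 → X) → 1 + (m ∸ 1) ≤ m + χ X?
    pointwise {zero} X? f = ≤-reflexive (sym (χ-yes X? (f refl)))
    pointwise {suc m} X? f = m≤m+n (suc m) _
    ∑-mult : ∑ mult U ≤ ∑ length blocks
    ∑-mult = begin
      ∑ mult U ≡⟨ ∑-cong U mult≡∑χ ⟩
      ∑ (λ v → ∑ (λ X → χ (v ∈? X)) blocks) U ≡⟨ ∑-swap (λ v X → χ (v ∈? X)) U blocks ⟩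
      ∑ (λ X → ∑ (λ v → χ (v ∈? X)) U) blocks
        ≤⟨ ∑-mono blocks (λ {X} _ → subst (_≤ length X) (length-filter≡∑χ (_∈? X) U)
            (unique-⊆⇒length≤ (Uniq.filter⁺ (_∈? X) uU) (filter-holds (_∈? X) U))) ⟩
      ∑ length blocks ∎

  repair : RepairSet k c G F
  repair = build (blocks ++ map (_∷ []) rest) refl
    where
    pieces = blocks ++ map (_∷ []) rest
    length-pieces : length pieces ≡ length blocks + length rest
    length-pieces = trans (length-++ blocks) (cong (length blocks +_) (length-map (_∷ []) rest))
    piece : ∀ {Sp : Edge → Set} → FillClosed c (V G) Sp → (∀ {e} → e ∈ F → Sp e) →
            ∀ {X} → X ∈ pieces → Unique X × X ⊆ V G × Full Sp X
    piece fc spF X∈ with ∈-++⁻ blocks X∈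
    ... | inj₁ X∈b = uniq , ∈-dedup⁻ ∘ ⊆-base , λ u∈ v∈ → fc (induced F _) (WF-⊆ (F⊆G ∘ filter-⊆ (inside? _)) wf)
            (∈-dedup⁻ ∘ ⊆-base ∘ V-induced F) connected (spF ∘ filter-⊆ (inside? _)) (spans u∈) (spans v∈)
      where open Block (block X∈b)
    ... | inj₂ X∈r with ∈-map⁻ (_∷ []) X∈r
    ... | v , v∈ , refl = [] ∷ [] , (λ { (here refl) → ∈-dedup⁻ (filter-⊆ uncovered? v∈) }) ,
          λ { (here refl) (here refl) lt → contradiction lt (<-irrefl refl) }
    covers : ∀ {v} → v ∈ V G → Any (v ∈_) pieces
    covers {v} v∈ with any? (v ∈?_) blocks
    ... | yes cov = AnyP.++⁺ˡ cov
    ... | no unc = AnyP.++⁺ʳ blocks (lose (∈-map⁺ (_∷ []) (∈-filter⁺ uncovered? (∈-dedup⁺ v∈) unc)) (here refl))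
    -- One piece is the start and the others are joined to it, so the number of pieces is one more
    -- than the number of joins. A piece exists because `U` is nonempty.
    build : ∀ Xs → Xs ≡ pieces → RepairSet k c G F
    build [] eq = contradiction (missing {ys = []} uU (≤-<-trans z≤n C<U)) λ { (v , v∈ , _) →
      none (subst (Any _) (sym eq) (covers (∈-dedup⁻ v∈))) }
      where
      none : {P : List ℕ → Set} → ¬ Any P []
      none ()
    build (X ∷ Xs) eq = joinAll c X Xs , size , full
      where
      sub : ∀ {Y} → Y ∈ X ∷ Xs → Y ∈ pieces
      sub {Y} Y∈ = subst (Y ∈_) eq Y∈
      size : k * length (joinAll c X Xs) ≤ length (filter (E._∉? F) G₀)
      size = ≤-trans (*-monoʳ-≤ k (length-joinAll c X Xs))
        (count-bound k c 1≤c (trans (sym length-pieces) (cong length (sym eq))) total-gain length-R count cover-size)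
      full : ∀ {Sp : Edge → Set} → FillClosed c (V G) Sp → (∀ {e} → e ∈ F → Sp e) →
             (∀ {e} → e ∈ joinAll c X Xs → Sp e) → Full Sp (V G)
      full fc spF spZ = let u , s , f = piece fc spF (sub (here refl)) in
        joinAll-full c 1≤c fc u s f (λ Y∈ → piece fc spF (sub (there Y∈))) spZ
          (λ z∈ → uncons (subst (Any _) (sym eq) (covers z∈)))
        where
        uncons : ∀ {z} → Any (z ∈_) (X ∷ Xs) → z ∈ X ⊎ Any (z ∈_) Xs
        uncons (here p) = inj₁ p
        uncons (there p) = inj₂ p

repairSet : ∀ {k c G F} → 1 ≤ c → WF G → F ⊆ G → Unique F → Connected (connectivity k c) G → RepairSet k c G F
repairSet {k} {c} {G} {F} 1≤c wf F⊆G uF conn = Repair.repair k c 1≤c G wf F F⊆G conn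
  (Decompose.decompose c 1≤c F (WF-⊆ F⊆G wf) uF (length U) U (dedup-! (V G)) ≤-refl 2c≤U)
  where
  U = dedup (V G)
  W = threshold k c
  1≤α : 1 ≤ degreeWeight k c
  1≤α = *-mono-≤ {1} {k + 4} {1} {c} (≤-trans (s≤s z≤n) (m≤n+m 4 k)) 1≤c
  c≤W : c ≤ W
  c≤W = ≤-trans (m≤m+n c (c + (c + (c + 0)))) (m≤n*m (4 * c) (degreeWeight k c) {{>-nonZero 1≤α}})
  2c≤U : 2 * c ≤ length U
  2c≤U with proj₁ conn
  ... | X , uX , X⊆ , lt = ≤-trans
    (≤-trans (+-mono-≤ c≤W (≤-reflexive (+-identityʳ c))) (+-monoˡ-≤ c (m≤m+n W (W + 0))))
    (≤-trans (<⇒≤ lt) (unique-⊆⇒length≤ uX (∈-dedup⁺ ∘ X⊆)))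

-- Unions of matroids

record Matroid : Set₁ where
  field
    Indep    : List Edge → Set
    unique : ∀ {I} → Indep I → Unique I
    down   : ∀ {I J} → Indep J → I ⊆ J → Unique I → Indep I
    aug    : ∀ {I J} → Indep I → Indep J → length I < length J → ∃[ e ] (e ∈ J × e ∉ I × Indep (e ∷ I))

module Span (M : Matroid) (A : Set) where
  open Matroid M

  -- With `A` empty and `J` independent this is membership in the closure of `J`; elements of `J`
  -- are included because independent lists have no repetitions.
  Sp : List Edge → Edge → Set
  Sp J e = Indep (e ∷ J) → A

  sp-mono : ∀ {J J′ e} → Unique J → J ⊆ J′ → Sp J e → Sp J′ e
  sp-mono uJ J⊆ sp ind = sp (down ind (∷-mono-⊆ J⊆) (unique-∷ (unique-head (unique ind) ∘ J⊆) uJ))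

  ∈⇒sp : ∀ {J e} → e ∈ J → Sp J e
  ∈⇒sp e∈ ind = contradiction e∈ (unique-head (unique ind))

  extend : ∀ {X Y} → Indep X → Indep Y → length X ≤ length Y →
           ∃[ X′ ] (Indep X′ × X ⊆ X′ × X′ ⊆ X ++ Y × length X′ ≡ length Y)
  extend {X} {Y} iX iY l≤ = go (length Y ∸ length X) iX (m∸n+n≡m l≤) id ∈-++⁺ˡ
    where
    go : ∀ n {X′} → Indep X′ → n + length X′ ≡ length Y → X ⊆ X′ → X′ ⊆ X ++ Y →
         ∃[ X″ ] (Indep X″ × X ⊆ X″ × X″ ⊆ X ++ Y × length X″ ≡ length Y)
    go zero {X′} i eq sub sup = X′ , i , sub , sup , eq
    go (suc n) {X′} i eq sub sup with aug i iY (subst (length X′ <_) eq (s≤s (m≤n+m _ n)))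
    ... | e , e∈ , e∉ , i′ = go n i′ (trans (+-suc n _) eq) (there ∘ sub) (∷-⊆ (∈-++⁺ʳ X e∈) sup)

  spanned-length : ∀ {J B} → Indep J → Indep B → (∀ {b} → b ∈ B → Sp J b) → length J < length B → A
  spanned-length iJ iB sp lt with aug iJ iB lt
  ... | b , b∈ , _ , ind = sp b∈ ind

  -- Extend `B` inside `B ++ J` to the length of `J`, then augment it from `e ∷ J`. This adds `e`,
  -- which `spe` handles, or an element of `J`, which makes an independent set longer than `J` but
  -- spanned by it.
  sp-trans : ∀ {J B e} → Indep J → Indep B → (∀ {b} → b ∈ B → Sp J b) → Sp B e → Sp J e
  sp-trans {J} {B} {e} iJ iB spB spe ieJ with length J <? length B
  ... | yes lt = spanned-length iJ iB spB lt
  ... | no ≮ with extend iB iJ (≮⇒≥ ≮)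
  ... | B′ , iB′ , B⊆ , B′⊆ , len with aug iB′ ieJ (s≤s (≤-reflexive len))
  ... | .e , here refl , e∉ , ind = spe (down ind (∷-mono-⊆ B⊆) (unique-∷ (e∉ ∘ B⊆) (unique iB)))
  ... | z , there z∈J , z∉ , ind = spanned-length iJ ind spz (s≤s (≤-reflexive (sym len)))
    where
    spz : ∀ {b} → b ∈ z ∷ B′ → Sp J b
    spz (here refl) = ∈⇒sp z∈J
    spz (there b∈) = [ spB , ∈⇒sp ]′ (∈-++⁻ B (B′⊆ b∈))

  -- If `f ∷ T` is independent, it extends inside `f ∷ L` to the length of `L` and omits a single
  -- `y` of `L`, outside `T`: this is an exchange of `y` for `f`. Without such exchanges the
  -- fundamental circuit of `f` stays within `f ∷ T`.
  exchange : ∀ {L T f} → Indep L → T ⊆ L → f ∉ L → Sp L f →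
    (∀ {y} → y ∈ L → y ∉ T → Indep (f ∷ filter (E._∉? (y ∷ [])) L) → A) → Sp T f
  exchange {L} {T} {f} iL T⊆ f∉ spf ex ifT with length (f ∷ T) ≤? length L
  ... | no ≰ = spf (down ifT (∷-mono-⊆ L⊆T) (unique-∷ f∉ (unique iL)))
    where
    L⊆T : L ⊆ T
    L⊆T {y} y∈ with y E.∈? T
    ... | yes p = p
    ... | no y∉ = contradiction (unique-⊆⇒length≤ (unique-∷ y∉ (unique-tail (unique ifT))) (∷-⊆ y∈ T⊆)) ≰
  ... | yes l≤ with extend ifT iL l≤
  ... | X , iX , fT⊆ , X⊆ , len
    with E.missing {xs = f ∷ L} {ys = X} (unique-∷ f∉ (unique iL)) (s≤s (≤-reflexive len))
  ... | .f , here refl , f∉X = contradiction (fT⊆ (here refl)) f∉X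
  ... | y , there y∈L , y∉X = ex y∈L (y∉X ∘ fT⊆ ∘ there)
    (down iX (∷-⊆ (fT⊆ (here refl)) sub)
      (unique-∷ (f∉ ∘ filter-⊆ (E._∉? (y ∷ []))) (Uniq.filter⁺ (E._∉? (y ∷ [])) (unique iL))))
    where
    X⊆fL : X ⊆ f ∷ L
    X⊆fL = [ ∷-mono-⊆ T⊆ , there ]′ ∘ ∈-++⁻ (f ∷ T) ∘ X⊆
    sub : filter (E._∉? (y ∷ [])) L ⊆ X
    sub {z} z∈ with z E.∈? X | ∈-filter⁻ (E._∉? (y ∷ [])) {xs = L} z∈
    ... | yes p | _ = p
    ... | no z∉X | z∈L , z≢y = contradiction
      (unique-⊆⇒length≤ {xs = z ∷ y ∷ X}
        (unique-∷ (λ { (here eq) → z≢y (here eq) ; (there z∈X) → z∉X z∈X }) (unique-∷ y∉X (unique iX)))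
        (∷-⊆ (there z∈L) (∷-⊆ (there y∈L) X⊆fL)))
      (<⇒≱ (s≤s (s≤s (≤-reflexive (sym len)))))

  -- Excluded middle for Indep is available relative to A: a refutation may call the other branch.
  greedy : ∀ Z {J} → Indep J → (∀ {J′} → Indep J′ → J ⊆ J′ → length J′ ≤ length J + length Z →
           (∀ {z} → z ∈ Z → Sp J′ z) → A) → A
  greedy [] iJ κ = κ iJ id (m≤m+n _ 0) λ ()
  greedy (z ∷ Z) {J} iJ κ = greedy Z iJ λ iJ′ J⊆ l sp → κ iJ′ J⊆ (≤-trans l (+-monoʳ-≤ (length J) (n≤1+n _)))
    λ { (here refl) → sp-mono (unique iJ) J⊆ take-z ; (there z∈) → sp z∈ }
    where
    take-z : Sp J z
    take-z izJ = greedy Z izJ λ iJ′ zJ⊆ l sp → κ iJ′ (zJ⊆ ∘ there)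
      (≤-trans l (≤-reflexive (sym (+-suc (length J) (length Z)))))
      λ { (here refl) → ∈⇒sp (zJ⊆ (here refl)) ; (there z∈) → sp z∈ }

-- Matroid union: partial colourings and chains of exchanges

module Union {k : ℕ} (M : Fin k → Matroid) (G₀ : List Edge) (uG : Unique G₀) where

  -- A partial colouring encodes the I_j as its colour classes, which makes them disjoint by
  -- construction.
  State : Set
  State = Edge → Maybe (Fin k)

  _≟M_ : DecidableEquality (Maybe (Fin k))
  _≟M_ = Maybe.≡-dec Fin._≟_

  cls : State → Fin k → List Edge
  cls t j = filter (λ e → t e ≟M just j) G₀

  coloured? : (t : State) → Decidable (λ e → t e ≢ nothing)
  coloured? t e = ¬? (t e ≟M nothing)

  coloured : State → List Edge
  coloured t = filter (coloured? t) G₀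

  size : State → ℕ
  size t = length (coloured t)

  Indep : Fin k → List Edge → Set
  Indep j = Matroid.Indep (M j)

  Valid : State → Set
  Valid t = ∀ j → Indep j (cls t j)

  uCls : ∀ t j → Unique (cls t j)
  uCls t j = Uniq.filter⁺ (λ e → t e ≟M just j) uG

  uCol : ∀ t → Unique (coloured t)
  uCol t = Uniq.filter⁺ (coloured? t) uG

  cls⁺ : ∀ {t j e} → e ∈ G₀ → t e ≡ just j → e ∈ cls t j
  cls⁺ {t} {j} = ∈-filter⁺ (λ e → t e ≟M just j)

  cls⁻ : ∀ t j {e} → e ∈ cls t j → e ∈ G₀ × t e ≡ just j
  cls⁻ t j = ∈-filter⁻ (λ e → t e ≟M just j) {xs = G₀}

  paint : State → Edge → Maybe (Fin k) → State
  paint t e x e′ with e′ ≟E e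
  ... | yes _ = x
  ... | no _  = t e′

  paint-at : ∀ t e x → paint t e x e ≡ x
  paint-at t e x with e ≟E e
  ... | yes _ = refl
  ... | no ≢ = contradiction refl ≢

  paint-off : ∀ t {e e′} x → e′ ≢ e → paint t e x e′ ≡ t e′
  paint-off t {e} {e′} x ≢ with e′ ≟E e
  ... | yes eq = contradiction eq ≢
  ... | no _ = refl

  just≢nothing : {A : Set} {x : Maybe A} {j : A} → x ≡ just j → x ≢ nothing
  just≢nothing refl ()

  insert-valid : ∀ {t p i} → Valid t → Indep i (p ∷ cls t i) → Valid (paint t p (just i))
  insert-valid {t} {p} {i} v ind j with j Fin.≟ i
  ... | yes refl = Matroid.down (M i) ind sub (uCls _ i)
    where
    sub : cls (paint t p (just i)) i ⊆ p ∷ cls t i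
    sub {e} e∈ with cls⁻ (paint t p (just i)) i e∈ | e ≟E p
    ... | _ | yes eq = here eq
    ... | e∈G , eq | no ≢ = there (cls⁺ e∈G (trans (sym (paint-off t (just i) ≢)) eq))
  ... | no j≢i = Matroid.down (M j) (v j) sub (uCls _ j)
    where
    sub : cls (paint t p (just i)) j ⊆ cls t j
    sub {e} e∈ with cls⁻ (paint t p (just i)) j e∈ | e ≟E p
    ... | _ , eq | yes refl = contradiction (Maybe.just-injective (trans (sym eq) (paint-at t p (just i)))) j≢i
    ... | e∈G , eq | no ≢ = cls⁺ e∈G (trans (sym (paint-off t (just i) ≢)) eq)

  insert-size : ∀ {t p i} → p ∈ G₀ → t p ≡ nothing → size t < size (paint t p (just i))
  insert-size {t} {p} {i} p∈ tp = unique-⊆⇒length≤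
    (unique-∷ (λ p∈c → filter-holds (coloured? t) G₀ p∈c tp) (uCol t))
    (∷-⊆ (∈-filter⁺ (coloured? t′) p∈ (just≢nothing (paint-at t p (just i)))) sub)
    where
    t′ = paint t p (just i)
    sub : coloured t ⊆ coloured t′
    sub {e} e∈ with ∈-filter⁻ (coloured? t) {xs = G₀} e∈
    ... | e∈G , col = ∈-filter⁺ (coloured? t′) e∈G
      (col ∘ trans (sym (paint-off t (just i) λ { refl → col tp })))

  swap-state : State → Edge → Edge → Fin k → State
  swap-state t p y i = paint (paint t y nothing) p (just i)

  module Swap {t : State} {p y : Edge} {i : Fin k} (tp : t p ≡ nothing) (ty : t y ≡ just i) where

    t′ : State
    t′ = swap-state t p y i

    y≢p : y ≢ p
    y≢p refl = just≢nothing ty tp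

    at-p : t′ p ≡ just i
    at-p = paint-at _ p (just i)

    at-y : t′ y ≡ nothing
    at-y = trans (paint-off _ (just i) y≢p) (paint-at t y nothing)

    elsewhere : ∀ {e} → e ≢ p → e ≢ y → t′ e ≡ t e
    elsewhere e≢p e≢y = trans (paint-off _ (just i) e≢p) (paint-off t nothing e≢y)

    cls-same : ∀ {e} → e ∈ cls t′ i → e ≢ p → e ∈ cls t i × e ≢ y
    cls-same {e} e∈ e≢p with cls⁻ t′ i e∈ | e ≟E y
    ... | _ , eq | yes refl = contradiction (trans (sym at-y) eq) λ ()
    ... | e∈G , eq | no e≢y = cls⁺ e∈G (trans (sym (elsewhere e≢p e≢y)) eq) , e≢y

    cls-other : ∀ {j} → j ≢ i → cls t′ j ⊆ cls t j
    cls-other {j} j≢i {e} e∈ with cls⁻ t′ j e∈ | e ≟E p | e ≟E y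
    ... | _ , eq | yes refl | _ = contradiction (Maybe.just-injective (trans (sym eq) at-p)) j≢i
    ... | _ , eq | no _ | yes refl = contradiction (trans (sym at-y) eq) λ ()
    ... | e∈G , eq | no e≢p | no e≢y = cls⁺ e∈G (trans (sym (elsewhere e≢p e≢y)) eq)

    swap-valid : Valid t → Indep i (p ∷ filter (E._∉? (y ∷ [])) (cls t i)) → Valid t′
    swap-valid v ind j with j Fin.≟ i
    ... | yes refl = Matroid.down (M i) ind sub (uCls _ i)
      where
      sub : cls t′ i ⊆ p ∷ filter (E._∉? (y ∷ [])) (cls t i)
      sub {e} e∈ with e ≟E p
      ... | yes eq = here eq
      ... | no e≢p with cls-same e∈ e≢p
      ... | e∈t , e≢y = there (∈-filter⁺ (E._∉? (y ∷ [])) e∈t (e≢y ∘ ∈-singleton))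
    ... | no j≢i = Matroid.down (M j) (v j) (cls-other j≢i) (uCls _ j)

    swap-size : p ∈ G₀ → size t ≤ size t′
    swap-size p∈ = s≤s⁻¹ (unique-⊆⇒length≤ {xs = p ∷ coloured t} {ys = y ∷ coloured t′}
      (unique-∷ (λ p∈c → filter-holds (coloured? t) G₀ p∈c tp) (uCol t))
      (∷-⊆ (there (∈-filter⁺ (coloured? t′) p∈ (just≢nothing at-p))) sub))
      where
      sub : coloured t ⊆ y ∷ coloured t′
      sub {e} e∈ with ∈-filter⁻ (coloured? t) {xs = G₀} e∈ | e ≟E y
      ... | _ | yes eq = here eq
      ... | e∈G , col | no e≢y = there (∈-filter⁺ (coloured? t′) e∈G
        (col ∘ trans (sym (elsewhere (λ { refl → col tp }) e≢y))))

  part : List Edge → State → Fin k → List Edge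
  part F t i = filter (E._∈? F) (cls t i)

  uPart : ∀ F t i → Unique (part F t i)
  uPart F t i = Uniq.filter⁺ (E._∈? F) (uCls t i)

  part⁻ : ∀ F t i {e} → e ∈ part F t i → e ∈ cls t i × e ∈ F
  part⁻ F t i = ∈-filter⁻ (E._∈? F) {xs = cls t i}

  -- Each element of the tree is freed, in the state attached to it, by a chain of exchanges starting from a.
  data Tree (a : State) : List (Edge × State) → Set where
    nil   : Tree a []
    root  : ∀ {Es f} → Tree a Es → f ∈ G₀ → a f ≡ nothing → Tree a ((f , a) ∷ Es)
    child : ∀ {Es p t y i} → Tree a Es → (p , t) ∈ Es → y ∈ G₀ → t y ≡ just i →
            Valid (swap-state t p y i) → Tree a ((y , swap-state t p y i) ∷ Es)

  support : List (Edge × State) → List Edge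
  support = map proj₁

  module Search (A : Set) (a : State) (va : Valid a) (maximal : ∀ t → Valid t → size a < size t → A) where

    module Sp j = Span (M j) A

    record Freed (f : Edge) (t : State) : Set where
      field
        member : f ∈ G₀
        free   : t f ≡ nothing
        valid  : Valid t
        big    : size a ≤ size t

    freed : ∀ {Es} → Tree a Es → ∀ {f t} → (f , t) ∈ Es → Freed f t
    freed (root tr f∈ af) (here refl) = record { member = f∈ ; free = af ; valid = va ; big = ≤-refl }
    freed (root tr _ _) (there x∈) = freed tr x∈
    freed (child {p = p} {t} {y} {i} tr p∈ y∈ ty v) (here refl) = record
      { member = y∈ ; free = Swap.at-y {t} {p} {y} {i} free ty ; valid = v
      ; big = ≤-trans big (Swap.swap-size {t} {p} {y} {i} free ty member) }
      where open Freed (freed tr p∈)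
    freed (child tr _ _ _ _) (there x∈) = freed tr x∈

    Violation : List (Edge × State) → Set
    Violation Es = ∃[ f ] ∃[ t ] ∃[ i ] ∃[ y ] ((f , t) ∈ Es × y ∈ G₀ × t y ≡ just i × y ∉ support Es ×
                     Indep i (f ∷ filter (E._∉? (y ∷ [])) (cls t i)))

    support-⊆ : ∀ {Es} → Tree a Es → support Es ⊆ G₀
    support-⊆ tr f∈ with ∈-map⁻ proj₁ f∈
    ... | (f , t) , x∈ , refl = Freed.member (freed tr x∈)

    Saturated : List (Edge × State) → Set
    Saturated Es = Tree a Es × Unique (support Es) × (∀ {f} → f ∈ G₀ → a f ≡ nothing → f ∈ support Es)

    -- Whether a violation exists is not decidable, so `κ` receives the tree with a handler: should
    -- `κ` exhibit a violation, it is run anew on the tree extended by it. `n` bounds the number of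
    -- extensions.
    grow : ∀ n {Es} → Saturated Es → length G₀ ≤ length Es + n →
           (∀ {Es} → Saturated Es → (Violation Es → A) → A) → A
    grow n {Es} sat@(tr , u , roots) l κ = κ sat (more n l)
      where
      more : ∀ n → length G₀ ≤ length Es + n → Violation Es → A
      more n l (f , t , i , y , x∈ , y∈ , ty , y∉ , ind) = continue n l
        where
        open Freed (freed tr x∈)
        Es′ = (y , swap-state t f y i) ∷ Es
        sat′ : Saturated Es′
        sat′ = child tr x∈ y∈ ty (Swap.swap-valid {t} {f} {y} {i} free ty valid ind) ,
               unique-∷ y∉ u , λ f∈ af → there (roots f∈ af)
        continue : ∀ n → length G₀ ≤ length Es + n → A
        continue zero l = contradiction
          (subst (_≤ length G₀) (length-map proj₁ Es′) (unique-⊆⇒length≤ (proj₁ (proj₂ sat′)) (support-⊆ (proj₁ sat′))))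
          (<⇒≱ (s≤s (subst (length G₀ ≤_) (+-identityʳ (length Es)) l)))
        continue (suc n) l = grow n sat′ (subst (length G₀ ≤_) (+-suc (length Es) n) l) κ

    initial : Saturated (map (_, a) (filter (λ e → a e ≟M nothing) G₀))
    initial = tree uncoloured (λ f∈ → ∈-filter⁻ (λ e → a e ≟M nothing) {xs = G₀} f∈) ,
              subst Unique (sym (fst uncoloured)) (Uniq.filter⁺ (λ e → a e ≟M nothing) uG) ,
              λ f∈ af → subst (_ ∈_) (sym (fst uncoloured)) (∈-filter⁺ (λ e → a e ≟M nothing) f∈ af)
      where
      uncoloured = filter (λ e → a e ≟M nothing) G₀
      tree : ∀ fs → (∀ {f} → f ∈ fs → f ∈ G₀ × a f ≡ nothing) → Tree a (map (_, a) fs)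
      tree [] _ = nil
      tree (f ∷ fs) h = root (tree fs (h ∘ there)) (proj₁ (h (here refl))) (proj₂ (h (here refl)))
      fst : ∀ fs → support (map (_, a) fs) ≡ fs
      fst [] = refl
      fst (f ∷ fs) = cong (f ∷_) (fst fs)

    module Closed {Es : List (Edge × State)} (tr : Tree a Es) (closed : Violation Es → A) where

      F : List Edge
      F = support Es

      -- Adding `f` to class `i` would enlarge the packing, and exchanging it for an edge outside
      -- `F` would be a violation; `exchange` then confines the circuit of `f` to `F`.
      own-span : ∀ {f t} → (f , t) ∈ Es → ∀ i → Sp.Sp i (part F t i) f
      own-span {f} {t} x∈ i = Sp.exchange i (valid i) (filter-⊆ (E._∈? F))
        (λ f∈ → just≢nothing (proj₂ (cls⁻ t i f∈)) free)
        (λ ind → maximal _ (insert-valid valid ind) (≤-<-trans big (insert-size member free)))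
        (λ y∈ y∉ ind → let y∈G , ty = cls⁻ t i y∈ in
           closed (f , t , i , _ , x∈ , y∈G , ty , (λ y∈F → y∉ (∈-filter⁺ (E._∈? F) y∈ y∈F)) , ind))
        where open Freed (freed tr x∈)

      -- This carries spans back over one exchange. In class `i` the part in `F` changes by
      -- replacing `y` with `p`, and `p` was already spanned, so nothing new becomes spanned; the
      -- other classes do not grow.
      swap-span : ∀ {t p y i} → Freed p t → p ∈ F → y ∈ G₀ → y ∈ F → t y ≡ just i → Valid (swap-state t p y i) →
        Sp.Sp i (part F t i) p → ∀ j {g} → Sp.Sp j (part F (swap-state t p y i) j) g → Sp.Sp j (part F t j) g
      swap-span {t} {p} {y} {i} fr p∈F y∈ y∈F ty v spp j {g} spg with j Fin.≟ i
      ... | no j≢i = Sp.sp-mono j (uPart F _ j) sub spg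
        where
        open Swap {t} {p} {y} {i} (Freed.free fr) ty
        sub : part F t′ j ⊆ part F t j
        sub e∈ with part⁻ F t′ j e∈
        ... | e∈c , e∈F = ∈-filter⁺ (E._∈? F) (cls-other j≢i e∈c) e∈F
      -- Augmenting `T′` from the longer `g ∷ T` adds `g`, which `spg` handles, or `y`; in the
      -- latter case `y ∷ T′` contains `p ∷ T`, which `spp` handles.
      ... | yes refl = λ indg → finish (aug indT′ indg (s≤s shorter))
        where
        open Freed fr
        open Swap {t} {p} {y} {i} free ty
        open Matroid (M i) using (aug; down; unique)
        T = part F t i
        T′ = part F t′ i
        indT′ : Indep i T′
        indT′ = down (v i) (filter-⊆ (E._∈? F)) (uPart F t′ i)
        y∉T′ : y ∉ T′
        y∉T′ y∈T′ = just≢nothing (proj₂ (cls⁻ t′ i (proj₁ (part⁻ F t′ i y∈T′)))) at-y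
        y∈T : y ∈ T
        y∈T = ∈-filter⁺ (E._∈? F) (cls⁺ y∈ ty) y∈F
        p∈T′ : p ∈ T′
        p∈T′ = ∈-filter⁺ (E._∈? F) (cls⁺ member at-p) p∈F
        T′⊆ : T′ ⊆ p ∷ T
        T′⊆ {e} e∈ with part⁻ F t′ i e∈ | e ≟E p
        ... | _ | yes eq = here eq
        ... | e∈c , e∈F | no e≢p = there (∈-filter⁺ (E._∈? F) (proj₁ (cls-same e∈c e≢p)) e∈F)
        p∉T : p ∉ T
        p∉T p∈T = just≢nothing (proj₂ (cls⁻ t i (proj₁ (part⁻ F t i p∈T)))) free
        T-stays : ∀ {e} → e ∈ T → e ≢ y → e ∈ T′
        T-stays {e} e∈ e≢y with part⁻ F t i e∈
        ... | e∈c , e∈F with cls⁻ t i e∈c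
        ... | e∈G , te = ∈-filter⁺ (E._∈? F) (cls⁺ e∈G (trans (elsewhere (λ { refl → just≢nothing te free }) e≢y) te)) e∈F
        shorter : length T′ ≤ length T
        shorter = s≤s⁻¹ (unique-⊆⇒length≤ {xs = y ∷ T′} {ys = p ∷ T}
          (unique-∷ y∉T′ (uPart F t′ i)) (∷-⊆ (there y∈T) T′⊆))
        pT⊆ : p ∷ T ⊆ y ∷ T′
        pT⊆ (here refl) = there p∈T′
        pT⊆ {e} (there e∈) with e ≟E y
        ... | yes eq = here eq
        ... | no e≢y = there (T-stays e∈ e≢y)
        finish : ∃[ z ] (z ∈ g ∷ T × z ∉ T′ × Indep i (z ∷ T′)) → A
        finish (z , here refl , _ , ind) = spg ind
        finish (z , there z∈ , z∉ , ind) with z ≟E y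
        ... | yes refl = spp (down ind pT⊆ (unique-∷ p∉T (uPart F t i)))
        ... | no z≢y = contradiction (T-stays z∈ z≢y) z∉

      -- Induction along the chain of exchanges back to `a`. Only `Es′` shrinks: `F` stays the
      -- support of the whole tree, to which `own-span` refers.
      transport : ∀ {Es′} → Tree a Es′ → Es′ ⊆ Es → ∀ {f t} → (f , t) ∈ Es′ →
                  ∀ j {g} → Sp.Sp j (part F t j) g → Sp.Sp j (part F a j) g
      transport (root tr′ _ _) sub (here refl) j sp = sp
      transport (root tr′ _ _) sub (there x∈) = transport tr′ (sub ∘ there) x∈
      transport (child {i = i} tr′ p∈ y∈ ty v) sub (here refl) j sp = transport tr′ (sub ∘ there) p∈ j
        (swap-span (freed tr′ p∈) (∈-map⁺ proj₁ (sub (there p∈))) y∈ (∈-map⁺ proj₁ (sub (here refl))) ty v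
          (own-span (sub (there p∈)) i) j sp)
      transport (child tr′ _ _ _ _) sub (there x∈) = transport tr′ (sub ∘ there) x∈

      spans-F : ∀ j {f} → f ∈ F → Sp.Sp j (part F a j) f
      spans-F j f∈ with ∈-map⁻ proj₁ f∈
      ... | (f , t) , x∈ , refl = transport tr id x∈ j (own-span x∈ j)

    tight : (∀ F → F ⊆ G₀ → Unique F → (∀ {f} → f ∈ G₀ → a f ≡ nothing → f ∈ F) →
             (∀ j {f} → f ∈ F → Sp.Sp j (part F a j) f) → A) → A
    tight κ = grow (length G₀) initial (m≤n+m _ _) λ { {Es} (tr , u , roots) closed →
      κ (support Es) (support-⊆ tr) u roots (Closed.spans-F tr closed) }

  -- By `roots` every edge of `G₀` outside `F` has a colour, and a coloured edge of `F` is counted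
  -- only in the part of its one colour.
  parts-size : ∀ {a F} → (∀ {f} → f ∈ G₀ → a f ≡ nothing → f ∈ F) →
    ∑ (λ j → length (part F a j)) (allFin k) + length (filter (E._∉? F) G₀) ≤ size a
  parts-size {a} {F} roots = begin
    ∑ (λ j → length (part F a j)) (allFin k) + length (filter (E._∉? F) G₀)
      ≤⟨ +-mono-≤ (∑-mono (allFin k) (λ {j} _ → part≤ j)) (≤-reflexive (length-filter≡∑χ (E._∉? F) G₀)) ⟩
    ∑ (λ j → ∑ (λ e → χ (both? j e)) G₀) (allFin k) + ∑ (λ e → χ (e E.∉? F)) G₀
      ≡⟨ cong (_+ ∑ (λ e → χ (e E.∉? F)) G₀) (∑-swap (λ j e → χ (both? j e)) (allFin k) G₀) ⟩
    ∑ (λ e → ∑ (λ j → χ (both? j e)) (allFin k)) G₀ + ∑ (λ e → χ (e E.∉? F)) G₀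
      ≡⟨ ∑-+ _ (λ e → χ (e E.∉? F)) G₀ ⟨
    ∑ (λ e → ∑ (λ j → χ (both? j e)) (allFin k) + χ (e E.∉? F)) G₀ ≤⟨ ∑-mono G₀ pointwise ⟩
    ∑ (λ e → χ (coloured? a e)) G₀ ≡⟨ length-filter≡∑χ (coloured? a) G₀ ⟨
    size a ∎
    where
    open ≤-Reasoning
    both? : ∀ j e → Dec (a e ≡ just j × e ∈ F)
    both? j e = (a e ≟M just j) ×-dec (e E.∈? F)
    part≤ : ∀ j → length (part F a j) ≤ ∑ (λ e → χ (both? j e)) G₀
    part≤ j = subst (length (part F a j) ≤_) (length-filter≡∑χ (both? j) G₀)
      (unique-⊆⇒length≤ (uPart F a j) λ e∈ → let e∈c , e∈F = part⁻ F a j e∈ ; e∈G , ae = cls⁻ a j e∈c in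
        ∈-filter⁺ (both? j) e∈G (ae , e∈F))
    colours : ∀ e js → (∀ {j} → a e ≡ just j → e ∈ F → j ∈ js) → ∑ (λ j → χ (both? j e)) (allFin k) ≤ length js
    colours e js h = subst (_≤ length js) (length-filter≡∑χ (λ j → both? j e) (allFin k))
      (unique-⊆⇒length≤ (Uniq.filter⁺ (λ j → both? j e) (Uniq.allFin⁺ k)) λ j∈ →
        let ae , e∈F = filter-holds (λ j → both? j e) (allFin k) j∈ in h ae e∈F)
    pointwise : ∀ {e} → e ∈ G₀ → ∑ (λ j → χ (both? j e)) (allFin k) + χ (e E.∉? F) ≤ χ (coloured? a e)
    pointwise {e} e∈ = cases (a e) refl (e E.∈? F)
      where
      cases : ∀ x → a e ≡ x → Dec (e ∈ F) →
              ∑ (λ j → χ (both? j e)) (allFin k) + χ (e E.∉? F) ≤ χ (coloured? a e)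
      cases nothing ae _ = subst₂ (λ m n → ∑ (λ j → χ (both? j e)) (allFin k) + m ≤ n)
        (sym (χ-no (e E.∉? F) λ e∉ → e∉ (roots e∈ ae))) (sym (χ-no (coloured? a e) λ col → col ae))
        (+-mono-≤ (colours e [] λ ae′ _ → contradiction ae (just≢nothing ae′)) z≤n)
      cases (just i) ae (yes e∈F) = subst₂ (λ m n → ∑ (λ j → χ (both? j e)) (allFin k) + m ≤ n)
        (sym (χ-no (e E.∉? F) λ e∉ → e∉ e∈F)) (sym (χ-yes (coloured? a e) (just≢nothing ae)))
        (+-mono-≤ {y = 1} (colours e (i ∷ []) λ ae′ _ → here (Maybe.just-injective (trans (sym ae′) ae))) z≤n)
      cases (just i) ae (no e∉F) = subst₂ (λ m n → ∑ (λ j → χ (both? j e)) (allFin k) + m ≤ n)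
        (sym (χ-yes (e E.∉? F) e∉F)) (sym (χ-yes (coloured? a e) (just≢nothing ae)))
        (+-mono-≤ {y = 0} (colours e [] λ _ e∈F → contradiction e∈F e∉F) ≤-refl)

-- The union of Lovász–Yemini families

∈⇒≤∑ : {X : Set} (f : X → ℕ) {xs : List X} {x : X} → x ∈ xs → f x ≤ ∑ f xs
∈⇒≤∑ f (here refl) = m≤m+n _ _
∈⇒≤∑ f {y ∷ _} (there x∈) = ≤-trans (∈⇒≤∑ f x∈) (m≤n+m _ (f y))

⊆K : ∀ {H X} → WF H → V H ⊆ X → H ⊆ K X
⊆K wf V⊆ e∈ = ∈K⁺ (V⊆ (∈V⁺ e∈ (inj₁ refl))) (V⊆ (∈V⁺ e∈ (inj₂ refl))) (All.lookup wf e∈)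

matroidOf : MatroidFamily → (G : Graph) → WF G → Matroid
matroidOf N G wf = record
  { Indep = Ind N G ; unique = ind-unique N G _ wf
  ; down = λ iJ → ind-down N G _ _ wf iJ ; aug = λ iI → ind-aug N G _ _ wf iI }

-- By rigidity a basis `B` of `H` has the rank of the complete graph on `V H`, so adding `uv` to it
-- would exceed that rank. `J` spans `B`, hence by transitivity also `uv`.
sp-fillClosed : ∀ {A : Set} N {c G J} → (∀ H → WF H → Connected c H → Rigid N H) →
  Ind N (K (V G)) J → FillClosed c (V G) (Span.Sp (matroidOf N (K (V G)) (WF-K (V G))) A J)
sp-fillClosed {A} N {c} {G} {J} rigid iJ H wfH V⊆ conn sp {u} {v} u∈ v∈ u<v = go (rigid H wfH conn)
  where
  open Span (matroidOf N (K (V G)) (WF-K (V G))) A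
  open Equivalence
  KH⊆ : K (V H) ⊆ K (V G)
  KH⊆ = ⊆K (WF-K (V H)) (V⊆ ∘ V-K)
  go : Rigid N H → Sp J (u , v)
  go (r , ((B , iB , B⊆ , lB) , _) , (_ , bound)) = sp-trans iJ iB′ (sp ∘ B⊆) λ iuB → contradiction
    (bound _ (from (ind-restr N (K (V G)) (K (V H)) _ (WF-K (V G)) (WF-K (V H)) KH⊆ uB⊆) iuB) uB⊆)
    (<⇒≱ (s≤s (≤-reflexive (sym lB))))
    where
    iB′ : Ind N (K (V G)) B
    iB′ = to (ind-restr N (K (V G)) H B (WF-K (V G)) wfH (⊆K wfH V⊆) B⊆) iB
    uB⊆ : (u , v) ∷ B ⊆ K (V H)
    uB⊆ = ∷-⊆ (∈K⁺ u∈ v∈ u<v) (⊆K wfH id ∘ B⊆)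

module Packing {k : ℕ} (Ms : Fin k → MatroidFamily) (c : ℕ) (1≤c : 1 ≤ c)
  (rigid : ∀ j H → WF H → Connected c H → Rigid (Ms j) H)
  (G : Graph) (wf : WF G) (conn : Connected (connectivity k c) G) where

  G₀ : Graph
  G₀ = E.dedup G

  open Union (λ j → matroidOf (Ms j) (K (V G)) (WF-K (V G))) G₀ (E.dedup-! G) public

  private
    c≤C : c ≤ connectivity k c
    c≤C = m≤n+m c (2 * threshold k c)

    rigidG : ∀ j → Rigid (Ms j) G
    rigidG j = rigid j G wf (connected-mono c≤C conn)

  rank : Fin k → ℕ
  rank j = proj₁ (rigidG j)

  rank-bound : ∀ j {I} → Ind (Ms j) (K (V G)) I → length I ≤ rank j
  rank-bound j {I} iI = proj₂ (proj₂ (proj₂ (rigidG j))) I iI (ind-⊆ (Ms j) (K (V G)) I (WF-K (V G)) iI)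

  total : ℕ
  total = ∑ rank (allFin k)

  Goal : Set
  Goal = ∃[ t ] (Valid t × total ≤ size t)

  improve : ∀ a → Valid a → (∀ t → Valid t → size a < size t → Goal) → Goal
  improve a va maximal = tight λ F F⊆ uF roots spF → conclude F F⊆ uF roots spF
    (repairSet {k} {c} 1≤c wf (E.∈-dedup⁻ ∘ F⊆) uF conn)
    where
    open Search Goal a va maximal
    conclude : ∀ F → F ⊆ G₀ → Unique F → (∀ {f} → f ∈ G₀ → a f ≡ nothing → f ∈ F) →
      (∀ j {f} → f ∈ F → Sp.Sp j (part F a j) f) → RepairSet k c G F → Goal
    conclude F F⊆ uF roots spF (Z , few , fill) =
      [ (λ { (j , _ , lt) → too-small j lt }) , enough ]′ (search (allFin k) λ {j} _ → <-≤-connex (bound j) (rank j))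
      where
      open ≤-Reasoning
      bound : Fin k → ℕ
      bound j = length (part F a j) + length Z
      enough : (∀ {j} → j ∈ allFin k → rank j ≤ bound j) → Goal
      enough all = a , va , (begin
        ∑ rank (allFin k) ≤⟨ ∑-mono (allFin k) all ⟩
        ∑ bound (allFin k) ≡⟨ ∑-+ _ (λ _ → length Z) (allFin k) ⟩
        ∑ (λ j → length (part F a j)) (allFin k) + ∑ (λ _ → length Z) (allFin k)
          ≡⟨ cong (∑ (λ j → length (part F a j)) (allFin k) +_)
               (trans (∑-const (length Z) (allFin k)) (cong (_* length Z) (length-tabulate {n = k} id))) ⟩
        ∑ (λ j → length (part F a j)) (allFin k) + k * length Z ≤⟨ +-monoʳ-≤ _ few ⟩
        ∑ (λ j → length (part F a j)) (allFin k) + length (filter (E._∉? F) G₀) ≤⟨ parts-size roots ⟩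
        size a ∎)
      -- Extending the part of class `j` greedily by `Z` spans F and Z, hence K_V(G), with fewer
      -- than `rank j` elements. Against a basis `B` this is absurd, which relative to the goal
      -- means that it yields `Goal`.
      too-small : ∀ j → bound j < rank j → Goal
      too-small j lt = go (proj₁ (proj₂ (proj₂ (rigidG j))))
        where
        iT : Ind (Ms j) (K (V G)) (part F a j)
        iT = ind-down (Ms j) _ _ _ (WF-K (V G)) (va j) (filter-⊆ (E._∈? F)) (uPart F a j)
        go : ∃[ B ] (Ind (Ms j) (K (V G)) B × B ⊆ K (V G) × length B ≡ rank j) → Goal
        go (B , iB , B⊆ , lB) = Sp.greedy j Z iT λ {J} iJ T⊆ lJ spZ →
          let full = fill {Sp.Sp j J} (sp-fillClosed (Ms j) {G = G} (rigid j) iJ)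
                       (λ f∈ → Sp.sp-mono j (uPart F a j) T⊆ (spF j f∈)) spZ in
          Sp.spanned-length j iJ iB (λ b∈ → let (u∈ , v∈) , u<v = ∈K⁻ (V G) (B⊆ b∈) in full u∈ v∈ u<v)
            (subst (length J <_) (sym lB) (≤-<-trans lJ lt))

  -- No maximal packing is ever singled out: `improve` may assume that larger packings yield `Goal`,
  -- and the recursion supplies this, `n` bounding the number of enlargements.
  packing : Goal
  packing = search-from (length G₀) (λ _ → nothing) blank (m≤n+m _ _)
    where
    blank : Valid (λ _ → nothing)
    blank j = ind-down (Ms j) _ _ _ (WF-K (V G)) (ind-empty (Ms j) _ (WF-K (V G)))
      (λ e∈ → contradiction (proj₂ (cls⁻ (λ _ → nothing) j e∈)) λ ()) (uCls _ j)
    search-from : ∀ n a → Valid a → length G₀ ≤ size a + n → Goal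
    search-from n a va l = improve a va (next n l)
      where
      next : ∀ n → length G₀ ≤ size a + n → ∀ t → Valid t → size a < size t → Goal
      next zero l t _ lt = contradiction (<-≤-trans lt (length-filter (coloured? t) G₀))
        (≤⇒≯ (subst (length G₀ ≤_) (+-identityʳ (size a)) l))
      next (suc n) l t vt lt = search-from n t vt (≤-trans l (≤-trans (≤-reflexive (+-suc (size a) n)) (+-monoˡ-≤ n lt)))

  -- A set independent in the union on K_V(G) is covered by one independent set for each `j`, so it
  -- has at most `total` elements, and the coloured edges reach this number already inside G.
  rigid-union : (M : MatroidFamily) → (∀ G I → WF G → Ind M G I ⇔ UnionInd Ms G I) → Goal → Rigid M G
  rigid-union M union (t , valid , large) = size t ,
    ((coloured t , indG , t⊆G , refl) , λ I iI I⊆ → bound I (to (ind-restr M Kn G I (WF-K (V G)) wf G⊆K I⊆) iI)) ,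
    ((coloured t , to (ind-restr M Kn G _ (WF-K (V G)) wf G⊆K t⊆G) indG , G⊆K ∘ t⊆G , refl) , λ I iI _ → bound I iI)
    where
    open Equivalence
    Kn = K (V G)
    G⊆K : G ⊆ Kn
    G⊆K = ⊆K wf id
    t⊆G : coloured t ⊆ G
    t⊆G = E.∈-dedup⁻ ∘ filter-⊆ (coloured? t)
    cls⊆G : ∀ j → cls t j ⊆ G
    cls⊆G j = E.∈-dedup⁻ ∘ proj₁ ∘ cls⁻ t j
    split : ∀ {e} → e ∈ coloured t → ∃[ j ] (e ∈ cls t j)
    split {e} e∈ = colour (t e) refl
      where
      colour : ∀ x → t e ≡ x → ∃[ j ] (e ∈ cls t j)
      colour nothing te = contradiction te (filter-holds (coloured? t) G₀ e∈)
      colour (just j) te = j , cls⁺ (filter-⊆ (coloured? t) e∈) te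
    join : ∀ {e} → ∃[ j ] (e ∈ cls t j) → e ∈ coloured t
    join (j , e∈) = ∈-filter⁺ (coloured? t) (proj₁ (cls⁻ t j e∈)) (just≢nothing (proj₂ (cls⁻ t j e∈)))
    indG : Ind M G (coloured t)
    indG = from (union G (coloured t) wf) (uCol t , cls t ,
      (λ j → from (ind-restr (Ms j) Kn G (cls t j) (WF-K (V G)) wf G⊆K (cls⊆G j)) (valid j)) ,
      λ e → mk⇔ split join)
    bound : ∀ I → Ind M Kn I → length I ≤ size t
    bound I iI = go (to (union Kn I (WF-K (V G))) iI)
      where
      open ≤-Reasoning
      go : UnionInd Ms Kn I → length I ≤ size t
      go (uI , Is , indIs , mem) = begin
        length I
          ≤⟨ unique-⊆⇒length≤ uI (λ {e} e∈ → let j , e∈j = to (mem e) e∈ in ∈-concatMap⁺ Is (lose (∈-allFin j) e∈j)) ⟩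
        length (concatMap Is (allFin k)) ≡⟨ length-concatMap Is (allFin k) ⟩
        ∑ (length ∘ Is) (allFin k) ≤⟨ ∑-mono (allFin k) (λ {j} _ → rank-bound j (indIs j)) ⟩
        total ≤⟨ large ⟩
        size t ∎

theorem3p18 : (k : ℕ) (Ms : Fin k → MatroidFamily) (M : MatroidFamily) →
    (∀ G I → WF G → Ind M G I ⇔ UnionInd Ms G I) →
    (∀ j → LovaszYemini (Ms j)) →
    LovaszYemini M
theorem3p18 k Ms M union LY = connectivity k c , λ G wf conn →
  let open Packing Ms c (s≤s z≤n) rigid G wf conn in rigid-union M union packing
  where
  c : ℕ
  -- The sum dominates every single constant, and the successor ensures `1 ≤ c`.
  c = suc (∑ (λ j → proj₁ (LY j)) (allFin k))

  rigid : ∀ j H → WF H → Connected c H → Rigid (Ms j) H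
  rigid j H wfH conn = proj₂ (LY j) H wfH (connected-mono (m≤n⇒m≤1+n (∈⇒≤∑ _ (∈-allFin j))) conn)
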